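{- Let $n\ge1$, let $T$ be the $2n\times 2$ matrix with rows $[x_i,y_i]$, $i=1,\dots,2n$, where the $x_i,y_i$ are independent indeterminates, and let $\Delta_i=x_{2i-1}y_{2i}+x_{2i}y_{2i-1}$ for $i=1,\dots,n$. Then $$ M(AD_{n};\mathrm{z}_T)=2^{n-1}\prod_{i=1}^n\Delta_i \prod_{\substack{1\le i\le 2n\\ i\neq2,\,2n-1}}x_i^{n/2}y_i^{n/2-1}\;M(AD_{n-2};\mathrm{z}_{\mathrm{t}(T)}) $$ for $n$ even, and $$ M(AD_{n};\mathrm{z}_T)=2^{n-1}\prod_{i=1}^n\Delta_i \prod_{\substack{1\le i\le 2n\\ i\neq2,\,2n-1}}x_i^{(n-1)/2}y_i^{(n-1)/2}\; M(AD_{n-2};\mathrm{z}_{\mathrm{t}(T)}) $$ for $n$ odd (where for $n=1$ the factor $M(AD_{n-2};\mathrm{z}_{\mathrm{t}(T)})$ is interpreted as $1$).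
   Context: For $n\ge0$, the Aztec diamond graph $AD_n$ has vertices $u_{i,j}$ ($0\le i\le n$, $1\le j\le n$) and $v_{i,j}$ ($1\le i\le n$, $0\le j\le n$), and $4n^2$ edges $\epsilon_{r,s}$, $1\le r,s\le 2n$ (the edge centers form a $2n\times2n$ array), where for $1\le i,j\le n$: $\epsilon_{2i-1,2j-1}=u_{i-1,j}v_{i,j-1}$, $\epsilon_{2i-1,2j}=u_{i-1,j}v_{i,j}$, $\epsilon_{2i,2j-1}=u_{i,j}v_{i,j-1}$, $\epsilon_{2i,2j}=u_{i,j}v_{i,j}$. $AD_0$ is the empty graph. The weight of a perfect matching is the product of the weights of its edges, and $M(G;\mathrm{wt})$ is the sum of the weights of all perfect matchings of $G$ (equal to $1$ for the empty graph). For a $2n\times2$ matrix $T$ with rows $[x_i,y_i]$, $\mathrm{z}_T$ is the weight on $AD_n$ assigning to $\epsilon_{r,s}$ the value $x_r$, $y_r$, $y_r$, $x_r$ according as $s\equiv 1,2,3,0 \pmod 4$. For $n\ge2$ the operator $\mathrm{t}$ sends $T$ to the $(2n-4)\times2$ matrix $\mathrm{t}(T)$ whose row $2k-1$ is $[\,1/x_{2k+2},\ 1/y_{2k+2}\,]$ and whose row $2k$ is $[\,1/x_{2k+1},\ 1/y_{2k+1}\,]$, for $k=1,\dots,n-2$. -}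

module Defs where

open import Algebra.Bundles using (CommutativeRing)
open import Data.Fin.Base using (Fin; suc; toℕ; inject₁; opposite; combine; remQuot)
open import Data.Fin.Patterns using (0F; 1F; 2F; 3F)
import Data.Fin.Properties as Fin
open import Data.List.Base
  using (List; []; _∷_; _++_; map; foldr; filter; length; allFin; cartesianProduct; cartesianProductWith)
open import Data.List.Membership.Propositional using (_∈_)
open import Data.List.Membership.Propositional.Properties
  using (∈-allFin; ∈-++⁺ˡ; ∈-++⁺ʳ; ∈-cartesianProduct⁺; ∈-cartesianProductWith⁺)
open import Data.List.Relation.Unary.Unique.Propositional using (Unique)
import Data.List.Relation.Unary.Unique.Propositional.Properties as Unique
open import Data.List.Relation.Unary.All using (All; all?)
open import Data.Nat.Base using (ℕ; zero; suc; NonZero; _*_; _∸_)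
open import Data.Nat.DivMod using (_mod_)
import Data.Nat.Properties as ℕ
open import Data.Product.Base using (_×_; _,_; proj₁; proj₂)
open import Data.Sum.Base using (_⊎_)
open import Level using (_⊔_)
open import Relation.Binary.Definitions using (DecidableEquality)
open import Relation.Binary.PropositionalEquality.Core using (_≡_; refl; cong₂)
open import Relation.Nullary.Decidable using (no; map′; ¬?; _×-dec_; _⊎-dec_)
open import Relation.Unary using (Decidable)

record FiniteGraph : Set₁ where
  field
    Vertex         : Set
    Edge           : Set
    ends           : Edge → Vertex × Vertex
    _≟_            : DecidableEquality Vertex
    vertices       : List Vertex
    edges          : List Edge
    vertices-all   : ∀ v → v ∈ vertices
    edges-all      : ∀ e → e ∈ edges
    edges-distinct : Unique edges

  _IncidentTo_ : Edge → Vertex → Set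
  e IncidentTo v = (proj₁ (ends e) ≡ v) ⊎ (proj₂ (ends e) ≡ v)

  incidentTo? : ∀ v → Decidable (_IncidentTo v)
  incidentTo? v e = (proj₁ (ends e) ≟ v) ⊎-dec (proj₂ (ends e) ≟ v)

  IsPerfectMatching : List Edge → Set
  IsPerfectMatching S = All (λ v → length (filter (incidentTo? v) S) ≡ 1) vertices

  isPerfectMatching? : Decidable IsPerfectMatching
  isPerfectMatching? S = all? (λ v → length (filter (incidentTo? v) S) ℕ.≟ 1) vertices

sublists : ∀ {a} {A : Set a} → List A → List (List A)
sublists []       = [] ∷ []
sublists (x ∷ xs) = map (x ∷_) (sublists xs) ++ sublists xs

-- Since `edges` has no repetitions, its sublists are exactly the sets of
-- edges, each occurring once.
perfectMatchings : (G : FiniteGraph) → List (List (FiniteGraph.Edge G))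
perfectMatchings G = filter isPerfectMatching? (sublists edges)
  where open FiniteGraph G

-- Indices running over 1..n (or 1..2n) are shifted to start at 0: the vertex
-- u_{i,j} is `u i (j-1)`, the vertex v_{i,j} is `v (i-1) j`, and the edge
-- ε_{r,s} is the pair (r-1 , s-1).

data ADVertex (n : ℕ) : Set where
  u : Fin (suc n) → Fin n → ADVertex n
  v : Fin n → Fin (suc n) → ADVertex n

_≟ᵥ_ : ∀ {n} → DecidableEquality (ADVertex n)
u i j ≟ᵥ u k l = map′ (λ (p , q) → cong₂ u p q) (λ { refl → refl , refl }) ((i Fin.≟ k) ×-dec (j Fin.≟ l))
u i j ≟ᵥ v k l = no λ ()
v i j ≟ᵥ u k l = no λ ()
v i j ≟ᵥ v k l = map′ (λ (p , q) → cong₂ v p q) (λ { refl → refl , refl }) ((i Fin.≟ k) ×-dec (j Fin.≟ l))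

-- i + a as an element of {0,…,n}, for a ∈ {0,1}
_⊕_ : ∀ {n} → Fin n → Fin 2 → Fin (suc n)
i ⊕ 0F = inject₁ i
i ⊕ 1F = suc i

-- Write the shifted indices as 2i+a and 2j+b with a, b ∈ {0,1}; these are
-- the row 2(i+1)-1+a and the column 2(j+1)-1+b.
ADends : ∀ {n} → Fin (n * 2) × Fin (n * 2) → ADVertex n × ADVertex n
ADends {n} (r , s) =
  let (i , a) = remQuot {n} 2 r
      (j , b) = remQuot {n} 2 s
  in u (i ⊕ a) j , v i (j ⊕ b)

AD : ℕ → FiniteGraph
AD n = record
  { Vertex         = ADVertex n
  ; Edge           = Fin (n * 2) × Fin (n * 2)
  ; ends           = ADends
  ; _≟_            = _≟ᵥ_
  ; vertices       = us ++ vs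
  ; edges          = cartesianProduct (allFin (n * 2)) (allFin (n * 2))
  ; vertices-all   = λ where
      (u i j) → ∈-++⁺ˡ (∈-cartesianProductWith⁺ u (∈-allFin i) (∈-allFin j))
      (v i j) → ∈-++⁺ʳ us (∈-cartesianProductWith⁺ v (∈-allFin i) (∈-allFin j))
  ; edges-all      = λ (r , s) → ∈-cartesianProduct⁺ (∈-allFin r) (∈-allFin s)
  ; edges-distinct = Unique.cartesianProduct⁺ (Unique.allFin⁺ (n * 2)) (Unique.allFin⁺ (n * 2))
  }
  where
  us vs : List (ADVertex n)
  us = cartesianProductWith u (allFin (suc n)) (allFin n)
  vs = cartesianProductWith v (allFin n) (allFin (suc n))

-- The 1-based row indices 1 ≤ i ≤ 2n with i ≠ 2 and i ≠ 2n-1, shifted.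
rows≢2,2n-1 : ∀ n → List (Fin (n * 2))
rows≢2,2n-1 n = filter
  (λ i → ¬? (suc (toℕ i) ℕ.≟ 2) ×-dec ¬? (suc (toℕ i) ℕ.≟ 2 * n ∸ 1))
  (allFin (n * 2))

-- The identity concerns Laurent polynomials with integer coefficients.  An
-- identity in independent indeterminates x_i, y_i and their inverses amounts
-- to the same identity for arbitrary units x_i, y_i of an arbitrary
-- commutative ring; the indeterminates themselves are the instance in which
-- the ring is ℤ[x_i^±1, y_i^±1] or ℚ(x_i, y_i).

module Weighted {c ℓ} (R : CommutativeRing c ℓ) where

  open CommutativeRing R renaming (_*_ to _·_)
  open import Algebra.Properties.Semiring.Exp semiring public using (_^_)

  ∑ ∏ : ∀ {a} {A : Set a} → List A → (A → Carrier) → Carrier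
  ∑ xs f = foldr (λ a t → f a + t) 0# xs
  ∏ xs f = foldr (λ a t → f a · t) 1# xs

  M : (G : FiniteGraph) → (FiniteGraph.Edge G → Carrier) → Carrier
  M G wt = ∑ (perfectMatchings G) (λ μ → ∏ μ wt)

  record Unit : Set (c ⊔ ℓ) where
    field
      value    : Carrier
      inverse  : Carrier
      inverseʳ : value · inverse ≈ 1#

  open Unit

  1/_ : Unit → Unit
  1/ a = record
    { value    = inverse a
    ; inverse  = value a
    ; inverseʳ = trans (*-comm (inverse a) (value a)) (inverseʳ a)
    }

  record Row : Set (c ⊔ ℓ) where
    constructor [_,_]
    field
      fst snd : Unit

  -- The matrices T with 2n rows and 2 columns, rows counted from 0.
  Matrix : ℕ → Set (c ⊔ ℓ)
  Matrix n = Fin (n * 2) → Row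

  x y : ∀ {k} → (Fin k → Row) → Fin k → Carrier
  x T r = value (Row.fst (T r))
  y T r = value (Row.snd (T r))

  z : ∀ {n} → Matrix n → Fin (n * 2) × Fin (n * 2) → Carrier
  z {n} T (r , s) with suc (toℕ s) mod 4
  ... | 1F = x T r
  ... | 2F = y T r
  ... | 3F = y T r
  ... | 0F = x T r

  -- With k and rows counted from 0, row 2k+a of t T (a ∈ {0,1}) is the
  -- entrywise inverse of row 2(k+1)+(1-a) of T.
  t : ∀ {m} → Matrix (suc (suc m)) → Matrix m
  t {m} T r =
    let (k , a)   = remQuot {m} 2 r
        [ p , q ] = T (combine (suc (inject₁ k)) (opposite a))
    in [ 1/ p , 1/ q ]

  Δ : ∀ {n} → Matrix n → Fin n → Carrier
  Δ {n} T i = x T (combine i 0F) · y T (combine i 1F) + x T (combine i 1F) · y T (combine i 0F)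

  -- M(AD_{n-2}; z_{t(T)}), interpreted as 1 for n = 1.
  M-AD[n-2] : ∀ n .{{_ : NonZero n}} → Matrix n → Carrier
  M-AD[n-2] (suc zero)    T = 1#
  M-AD[n-2] (suc (suc m)) T = M (AD m) (z {m} (t {m} T))

{-# OPTIONS --safe #-}
module Submission where

-- Urban renewal, applied twice.  Cut AD_n into n strips of two edge rows.  Scanning a
-- strip from left to right gives a product of 2×2 transfer matrices, one per 2×2
-- cell of edges, and complementing all states exchanges the transfer matrix of a
-- cell with that of its half-turn, up to a scalar and a diagonal gauge.
-- When ad + bc = δ ω with δ constant along the strip, the gauge telescopes
-- to one factor δ per strip, so no δ is ever divided by, and AD_n becomes AD_{n-1}
-- with the half-turned cells, divided by ω, and the outermost edges removed.
--
-- For z_T take δ = Δ_i and ω = 1.  The new cells have constant rows p p / q q, with p, q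
-- entries of T; for these take δ = 2 and ω = p q.  The third weight is then
-- z_{t(T)}, and the factors p q make up the monomial.

open import Defs
open import Algebra.Bundles using (CommutativeRing)
open import Data.Bool.Base using (Bool; true; false; not; if_then_else_; _∧_; _∨_)
open import Data.Bool.Properties using (not-involutive; ∨-identityʳ)
open import Data.Empty using (⊥)
open import Data.Fin.Base as Fin using (Fin; toℕ; combine; remQuot; opposite; inject₁)
open import Data.Fin.Patterns using (0F; 1F; 2F; 3F)
import Data.Fin.Properties as Fin
open import Data.List.Base
  using (List; []; _∷_; _++_; map; filter; length; allFin; cartesianProduct; cartesianProductWith)
open import Data.List.Properties using (map-∘; map-++; map-id; map-tabulate)
open import Data.List.Relation.Unary.All using (all?)
open import Data.Nat.Base as ℕ using (ℕ; zero; suc; _≡ᵇ_; NonZero; _∸_; _/_)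
open import Data.Nat.DivMod using (_mod_; m*n/n≡m)
open import Data.Nat.Divisibility using (_∣_; _∤_; divides)
import Data.Nat.Properties as ℕ
open import Data.Product.Base using (_×_; _,_; proj₁; proj₂)
open import Data.Vec.Base as Vec using (Vec; []; _∷_; _∷ʳ_; replicate)
import Data.Vec.Properties as Vec
open import Function.Base using (_∘_; id)
open import Level using (Level)
open import Relation.Binary.PropositionalEquality as ≡ using (_≡_)
open import Relation.Nullary.Decidable using (does)
open import Relation.Nullary.Negation using (contradiction)
open import Relation.Unary using (Decidable)

-- In an arbitrary commutative ring only the entries of `T` are known to be invertible: `Δ` and 2
-- may be zero divisors or zero, so the usual renewed weights, quotients by ad + bc, need not exist.
-- Complementation of states works because a cell whose two vertices are both to be covered
-- contributes ad + bc, one with neither contributes 1, and the complement puts these two entries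
-- opposite each other. The first half-turn puts rows 2 and 2n-1 of `T` on the outermost edge rows,
-- with which they disappear; this is why the monomial omits them. Every other row of `T` gives one
-- row of n-1 middle cells, with entries x, y, x, y and so on; counting these gives the exponents
-- for either parity of n. Weights are functions on all of ℕ, so that going to the rest of a strip,
-- to the next strip or to the smaller diamond is composition with `suc`.

∁ : ∀ {k} → Vec Bool k → Vec Bool k
∁ = Vec.map not

∁-involutive : ∀ {k} (S : Vec Bool k) → ∁ (∁ S) ≡ S
∁-involutive S = ≡.trans (≡.sym (Vec.map-∘ not not S))
                         (≡.trans (Vec.map-cong not-involutive S) (Vec.map-id S))

bits : ∀ k → List (Vec Bool k)
bits zero    = [] ∷ []
bits (suc k) = map (true ∷_) (bits k) ++ map (false ∷_) (bits k)

interleave : ∀ {a} {A : Set a} {k} → Vec A k → Vec A k → Vec A (k ℕ.* 2)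
interleave []       []       = []
interleave (a ∷ as) (b ∷ bs) = a ∷ b ∷ interleave as bs

interleave-∷ʳ : ∀ {a} {A : Set a} {k} (as : Vec A (suc k)) (bs : Vec A k) c →
                interleave as (bs ∷ʳ c) ≡
                Vec.head as ∷ (interleave bs (Vec.tail as) ∷ʳ c)
interleave-∷ʳ (a ∷ [])      []       c = ≡.refl
interleave-∷ʳ (a ∷ a′ ∷ as) (b ∷ bs) c =
  ≡.cong (λ l → a ∷ b ∷ l) (interleave-∷ʳ (a′ ∷ as) bs c)

-- Lattice coordinates for edges and vertices.

-- Put the edge (r , s) on the unit square with lower corner (r , s), and the vertices
-- `u i j` and `v i j` on the points (2i , 2j+1) and (2i+1 , 2j).  An edge joins
-- the two corners of its square whose coordinates have an odd sum.
near : ℕ → ℕ → Bool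
near q s = (s ≡ᵇ q) ∨ (suc s ≡ᵇ q)

-- The unit interval at `a + 2i` has one even end, `2 (a + i)`, and one odd end, `2i + 1`. The even
-- end follows `⊕`; the odd end, treated in `near-odd`, forgets `a`. These are the two kinds of
-- index that occur in `ADends`.
near-even : ∀ k i (a : Fin 2) → near (k ℕ.* 2) (toℕ a ℕ.+ i ℕ.* 2) ≡ (toℕ a ℕ.+ i ≡ᵇ k)
near-even zero          zero    0F = ≡.refl
near-even zero          zero    1F = ≡.refl
near-even (suc k)       zero    0F = ≡.refl
near-even (suc zero)    zero    1F = ≡.refl
near-even (suc (suc k)) zero    1F = ≡.refl
near-even zero          (suc i) 0F = ≡.refl
near-even zero          (suc i) 1F = ≡.refl
near-even (suc k)       (suc i) 0F = near-even k i 0F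
near-even (suc k)       (suc i) 1F = near-even k i 1F

near-odd : ∀ k i (a : Fin 2) → near (suc (k ℕ.* 2)) (toℕ a ℕ.+ i ℕ.* 2) ≡ (i ≡ᵇ k)
near-odd zero    zero    0F = ≡.refl
near-odd zero    zero    1F = ≡.refl
near-odd (suc k) zero    0F = ≡.refl
near-odd (suc k) zero    1F = ≡.refl
near-odd zero    (suc i) 0F = ≡.refl
near-odd zero    (suc i) 1F = ≡.refl
near-odd (suc k) (suc i) 0F = near-odd k i 0F
near-odd (suc k) (suc i) 1F = near-odd k i 1F

-- Counting in lists, and the degree of a point in a set of edges.

module _ {a} {A : Set a} where

  count : (A → Bool) → List A → ℕ
  count p []       = 0
  count p (x ∷ xs) = if p x then suc (count p xs) else count p xs

  count-false : ∀ {p} → (∀ x → p x ≡ false) → ∀ xs → count p xs ≡ 0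
  count-false eq []       = ≡.refl
  count-false eq (x ∷ xs) rewrite eq x = count-false eq xs

  count-cong : ∀ {p p′} → (∀ x → p x ≡ p′ x) → ∀ xs → count p xs ≡ count p′ xs
  count-cong eq []       = ≡.refl
  count-cong eq (x ∷ xs) rewrite eq x | count-cong eq xs = ≡.refl

  count-++ : ∀ p xs ys → count p (xs ++ ys) ≡ count p xs ℕ.+ count p ys
  count-++ p []       ys = ≡.refl
  count-++ p (x ∷ xs) ys with p x
  ... | true  = ≡.cong suc (count-++ p xs ys)
  ... | false = count-++ p xs ys

  length-filter : ∀ {ℓ} {P : A → Set ℓ} (P? : Decidable P) xs →
                  length (filter P? xs) ≡ count (does ∘ P?) xs
  length-filter P? []       = ≡.refl
  length-filter P? (x ∷ xs) with does (P? x)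
  ... | true  = ≡.cong suc (length-filter P? xs)
  ... | false = length-filter P? xs

module _ {a b} {A : Set a} {B : Set b} where

  count-map : ∀ p (f : A → B) xs → count p (map f xs) ≡ count (p ∘ f) xs
  count-map p f []       = ≡.refl
  count-map p f (x ∷ xs) rewrite count-map p f xs = ≡.refl

  sublists-map : ∀ (f : A → B) xs → sublists (map f xs) ≡ map (map f) (sublists xs)
  sublists-map f []       = ≡.refl
  sublists-map f (x ∷ xs) rewrite sublists-map f xs = begin
    map (f x ∷_) (map (map f) (sublists xs)) ++ map (map f) (sublists xs)
      ≡⟨ ≡.cong (_++ map (map f) (sublists xs)) (map-∘ (sublists xs)) ⟨
    map (map f ∘ (x ∷_)) (sublists xs) ++ map (map f) (sublists xs)
      ≡⟨ ≡.cong (_++ map (map f) (sublists xs)) (map-∘ (sublists xs)) ⟩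
    map (map f) (map (x ∷_) (sublists xs)) ++ map (map f) (sublists xs)
      ≡⟨ map-++ (map f) (map (x ∷_) (sublists xs)) (sublists xs) ⟨
    map (map f) (map (x ∷_) (sublists xs) ++ sublists xs) ∎
    where open ≡.≡-Reasoning

touches : ℕ → ℕ → ℕ × ℕ → Bool
touches p q (r , s) = near p r ∧ near q s

degree : ℕ → ℕ → List (ℕ × ℕ) → ℕ
degree p q = count (touches p q)

inRow : ℕ → ℕ → ℕ × ℕ
inRow r s = r , s

shift : ℕ × ℕ → ℕ × ℕ
shift (r , s) = suc (suc r) , s

strip : List ℕ → List ℕ → List (ℕ × ℕ) → List (ℕ × ℕ)
strip α β ρ = map (inRow 0) α ++ (map (inRow 1) β ++ map shift ρ)

degree-strip : ∀ p q α β ρ → degree p q (strip α β ρ) ≡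
  count (touches p q ∘ inRow 0) α ℕ.+
  (count (touches p q ∘ inRow 1) β ℕ.+ count (touches p q ∘ shift) ρ)
degree-strip p q α β ρ =
  ≡.trans (count-++ T (map (inRow 0) α) (map (inRow 1) β ++ map shift ρ))
    (≡.cong₂ ℕ._+_ (count-map T (inRow 0) α)
      (≡.trans (count-++ T (map (inRow 1) β) (map shift ρ))
        (≡.cong₂ ℕ._+_ (count-map T (inRow 1) β) (count-map T shift ρ))))
  where T = touches p q

-- Degrees are local: height 0 sees only the first edge row, height 1 the first two, height 2 the
-- second row and the strips below, and greater heights only the strips below. These four cases let
-- the degree conditions split along strips in `below-strip`.
degree-strip-0 : ∀ q α β ρ → degree 0 q (strip α β ρ) ≡ count (near q) α
degree-strip-0 q α β ρ
  rewrite degree-strip 0 q α β ρ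
        | count-false {p = λ s → false} (λ _ → ≡.refl) β
        | count-false {p = λ (e : ℕ × ℕ) → false} (λ _ → ≡.refl) ρ
        = ℕ.+-identityʳ _

degree-strip-1 : ∀ q α β ρ → degree 1 q (strip α β ρ) ≡ count (near q) α ℕ.+ count (near q) β
degree-strip-1 q α β ρ
  rewrite degree-strip 1 q α β ρ
        | count-false {p = λ (e : ℕ × ℕ) → false} (λ _ → ≡.refl) ρ
        = ≡.cong (count (near q) α ℕ.+_) (ℕ.+-identityʳ _)

degree-strip-2 : ∀ q α β ρ → degree 2 q (strip α β ρ) ≡ count (near q) β ℕ.+ degree 0 q ρ
degree-strip-2 q α β ρ
  rewrite degree-strip 2 q α β ρ
        | count-false {p = λ (s : ℕ) → false} (λ _ → ≡.refl) α
        = ≡.refl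

degree-strip-3+ : ∀ p q α β ρ → degree (suc (suc (suc p))) q (strip α β ρ) ≡ degree (suc p) q ρ
degree-strip-3+ p q α β ρ
  rewrite degree-strip (suc (suc (suc p))) q α β ρ
        | count-false {p = λ (s : ℕ) → false} (λ _ → ≡.refl) α
        | count-false {p = λ (s : ℕ) → false} (λ _ → ≡.refl) β
        = ≡.refl

-- The edge list of `AD n` cut into strips.

cols : ℕ → List ℕ
cols zero    = []
cols (suc k) = 0 ∷ map suc (cols k)

strips : ℕ → ℕ → List (ℕ × ℕ)
strips zero    k = []
strips (suc m) k = strip (cols k) (cols k) (strips m k)

allFin-suc : ∀ k → allFin (suc k) ≡ Fin.zero ∷ map Fin.suc (allFin k)
allFin-suc k = ≡.cong (Fin.zero ∷_) (≡.sym (map-tabulate id Fin.suc))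

map-toℕ-allFin : ∀ k → map toℕ (allFin k) ≡ cols k
map-toℕ-allFin zero    = ≡.refl
map-toℕ-allFin (suc k) = begin
  map toℕ (allFin (suc k))            ≡⟨ ≡.cong (map toℕ) (allFin-suc k) ⟩
  0 ∷ map toℕ (map Fin.suc (allFin k)) ≡⟨ ≡.cong (0 ∷_) (map-∘ {g = toℕ} {f = Fin.suc} (allFin k)) ⟨
  0 ∷ map (suc ∘ toℕ) (allFin k)      ≡⟨ ≡.cong (0 ∷_) (map-∘ {g = suc} {f = toℕ} (allFin k)) ⟩
  0 ∷ map suc (map toℕ (allFin k))    ≡⟨ ≡.cong (λ l → 0 ∷ map suc l) (map-toℕ-allFin k) ⟩
  cols (suc k)                        ∎
  where open ≡.≡-Reasoning

cartesianProduct-map : ∀ {a b c d} {A : Set a} {B : Set b} {C : Set c} {D : Set d}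
  (f : A → C) (g : B → D) xs ys →
  cartesianProduct (map f xs) (map g ys) ≡ map (λ (x , y) → f x , g y) (cartesianProduct xs ys)
cartesianProduct-map f g []       ys = ≡.refl
cartesianProduct-map f g (x ∷ xs) ys = begin
  map (f x ,_) (map g ys) ++ cartesianProduct (map f xs) (map g ys)
    ≡⟨ ≡.cong₂ _++_ (≡.trans (≡.sym (map-∘ ys)) (map-∘ ys)) (cartesianProduct-map f g xs ys) ⟩
  map (λ (x , y) → f x , g y) (map (x ,_) ys) ++ map (λ (x , y) → f x , g y) (cartesianProduct xs ys)
    ≡⟨ map-++ (λ (x , y) → f x , g y) (map (x ,_) ys) _ ⟨
  map (λ (x , y) → f x , g y) (cartesianProduct (x ∷ xs) ys) ∎
  where open ≡.≡-Reasoning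

strips≡cartesianProduct : ∀ m k → cartesianProduct (cols (m ℕ.* 2)) (cols k) ≡ strips m k
strips≡cartesianProduct zero    k = ≡.refl
strips≡cartesianProduct (suc m) k =
  ≡.cong (λ l → map (inRow 0) (cols k) ++ (map (inRow 1) (cols k) ++ l)) (begin
    cartesianProduct (map suc (map suc (cols (m ℕ.* 2)))) (cols k)
      ≡⟨ ≡.cong₂ cartesianProduct (map-∘ {g = suc} {f = suc} (cols (m ℕ.* 2))) (map-id (cols k)) ⟨
    cartesianProduct (map (λ r → suc (suc r)) (cols (m ℕ.* 2))) (map id (cols k))
      ≡⟨ cartesianProduct-map {C = ℕ} (λ r → suc (suc r)) id (cols (m ℕ.* 2)) (cols k) ⟩
    map shift (cartesianProduct (cols (m ℕ.* 2)) (cols k))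
      ≡⟨ ≡.cong (map shift) (strips≡cartesianProduct m k) ⟩
    map shift (strips m k) ∎)
  where open ≡.≡-Reasoning

toℕ² : ∀ {k l} → Fin k × Fin l → ℕ × ℕ
toℕ² (r , s) = toℕ r , toℕ s

-- `sublists` depends on the order of the list; the row by row order of `cartesianProduct` is
-- already the order of the strips, so the two lists agree exactly.
edges≡strips : ∀ n → map toℕ² (FiniteGraph.edges (AD n)) ≡ strips n (n ℕ.* 2)
edges≡strips n = begin
  map toℕ² (cartesianProduct (allFin (n ℕ.* 2)) (allFin (n ℕ.* 2)))
    ≡⟨ cartesianProduct-map toℕ toℕ (allFin (n ℕ.* 2)) (allFin (n ℕ.* 2)) ⟨
  cartesianProduct (map toℕ (allFin (n ℕ.* 2))) (map toℕ (allFin (n ℕ.* 2)))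
    ≡⟨ ≡.cong₂ cartesianProduct (map-toℕ-allFin (n ℕ.* 2)) (map-toℕ-allFin (n ℕ.* 2)) ⟩
  cartesianProduct (cols (n ℕ.* 2)) (cols (n ℕ.* 2))
    ≡⟨ strips≡cartesianProduct n (n ℕ.* 2) ⟩
  strips n (n ℕ.* 2) ∎
  where open ≡.≡-Reasoning

toℕ-remQuot : ∀ {n} (r : Fin (n ℕ.* 2)) → let (i , a) = remQuot {n} 2 r in
              toℕ r ≡ toℕ a ℕ.+ toℕ i ℕ.* 2
toℕ-remQuot {n} r = let (i , a) = remQuot {n} 2 r in begin
  toℕ r                   ≡⟨ ≡.cong toℕ (Fin.combine-remQuot {n} 2 r) ⟨
  toℕ (combine i a)       ≡⟨ Fin.toℕ-combine i a ⟩
  2 ℕ.* toℕ i ℕ.+ toℕ a     ≡⟨ ℕ.+-comm (2 ℕ.* toℕ i) (toℕ a) ⟩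
  toℕ a ℕ.+ 2 ℕ.* toℕ i     ≡⟨ ≡.cong (toℕ a ℕ.+_) (ℕ.*-comm 2 (toℕ i)) ⟩
  toℕ a ℕ.+ toℕ i ℕ.* 2     ∎
  where open ≡.≡-Reasoning

toℕ-⊕ : ∀ {n} (i : Fin n) a → toℕ (i ⊕ a) ≡ toℕ a ℕ.+ toℕ i
toℕ-⊕ i 0F = Fin.toℕ-inject₁ i
toℕ-⊕ i 1F = ≡.refl

does-≟ : ∀ {n} (i j : Fin n) → does (i Fin.≟ j) ≡ (toℕ i ≡ᵇ toℕ j)
does-≟ Fin.zero    Fin.zero    = ≡.refl
does-≟ Fin.zero    (Fin.suc j) = ≡.refl
does-≟ (Fin.suc i) Fin.zero    = ≡.refl
does-≟ (Fin.suc i) (Fin.suc j) = does-≟ i j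

point : ∀ {n} → ADVertex n → ℕ × ℕ
point (u i j) = toℕ i ℕ.* 2 , suc (toℕ j ℕ.* 2)
point (v i j) = suc (toℕ i ℕ.* 2) , toℕ j ℕ.* 2

near-⊕ : ∀ {n} (r : Fin (n ℕ.* 2)) k → let (i , a) = remQuot {n} 2 r in
         does ((i ⊕ a) Fin.≟ k) ≡ near (toℕ k ℕ.* 2) (toℕ r)
near-⊕ {n} r k = let (i , a) = remQuot {n} 2 r in begin
  does ((i ⊕ a) Fin.≟ k)                       ≡⟨ does-≟ (i ⊕ a) k ⟩
  (toℕ (i ⊕ a) ≡ᵇ toℕ k)                       ≡⟨ ≡.cong (_≡ᵇ toℕ k) (toℕ-⊕ i a) ⟩
  (toℕ a ℕ.+ toℕ i ≡ᵇ toℕ k)                   ≡⟨ near-even (toℕ k) (toℕ i) a ⟨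
  near (toℕ k ℕ.* 2) (toℕ a ℕ.+ toℕ i ℕ.* 2)       ≡⟨ ≡.cong (near (toℕ k ℕ.* 2)) (toℕ-remQuot {n} r) ⟨
  near (toℕ k ℕ.* 2) (toℕ r)                     ∎
  where open ≡.≡-Reasoning

near-quotient : ∀ {n} (r : Fin (n ℕ.* 2)) k → let (i , a) = remQuot {n} 2 r in
                does (i Fin.≟ k) ≡ near (suc (toℕ k ℕ.* 2)) (toℕ r)
near-quotient {n} r k = let (i , a) = remQuot {n} 2 r in begin
  does (i Fin.≟ k)                             ≡⟨ does-≟ i k ⟩
  (toℕ i ≡ᵇ toℕ k)                             ≡⟨ near-odd (toℕ k) (toℕ i) a ⟨
  near (suc (toℕ k ℕ.* 2)) (toℕ a ℕ.+ toℕ i ℕ.* 2) ≡⟨ ≡.cong (near (suc (toℕ k ℕ.* 2))) (toℕ-remQuot {n} r) ⟨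
  near (suc (toℕ k ℕ.* 2)) (toℕ r)               ∎
  where open ≡.≡-Reasoning

incidentTo?-point : ∀ {n} (w : ADVertex n) ((r , s) : Fin (n ℕ.* 2) × Fin (n ℕ.* 2)) →
  does (FiniteGraph.incidentTo? (AD n) w (r , s)) ≡
  near (proj₁ (point w)) (toℕ r) ∧ near (proj₂ (point w)) (toℕ s)
incidentTo?-point {n} (u k l) (r , s) =
  ≡.trans (∨-identityʳ _) (≡.cong₂ _∧_ (near-⊕ {n} r k) (near-quotient {n} s l))
incidentTo?-point {n} (v k l) (r , s) = ≡.cong₂ _∧_ (near-quotient {n} r k) (near-⊕ {n} s l)

length-incident : ∀ {n} (w : ADVertex n) μ →
  length (filter (FiniteGraph.incidentTo? (AD n) w) μ) ≡
  degree (proj₁ (point w)) (proj₂ (point w)) (map toℕ² μ)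
length-incident {n} w μ = begin
  length (filter (FiniteGraph.incidentTo? (AD n) w) μ)
    ≡⟨ length-filter (FiniteGraph.incidentTo? (AD n) w) μ ⟩
  count (does ∘ FiniteGraph.incidentTo? (AD n) w) μ
    ≡⟨ count-cong (incidentTo?-point w) μ ⟩
  count (λ (r , s) → near (proj₁ (point w)) (toℕ r) ∧ near (proj₂ (point w)) (toℕ s)) μ
    ≡⟨ count-map _ toℕ² μ ⟨
  degree (proj₁ (point w)) (proj₂ (point w)) (map toℕ² μ) ∎
  where open ≡.≡-Reasoning

-- The column pattern p q q p of period four, and the half-turn of cells on indices.

pick : ∀ {a} {A : Set a} → ℕ → A → A → A
pick zero          p q = p
pick (suc zero)    p q = q
pick (suc (suc s)) p q = pick s q p

-- Applied to both coordinates of an edge, this is the half-turn of every cell.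
swap₂ : ℕ → ℕ
swap₂ zero          = 1
swap₂ (suc zero)    = 0
swap₂ (suc (suc r)) = suc (suc (swap₂ r))

swap₂-even : ∀ i → swap₂ (i ℕ.* 2) ≡ suc (i ℕ.* 2)
swap₂-even zero    = ≡.refl
swap₂-even (suc i) = ≡.cong (λ r → suc (suc r)) (swap₂-even i)

swap₂-odd : ∀ i → swap₂ (suc (i ℕ.* 2)) ≡ i ℕ.* 2
swap₂-odd zero    = ≡.refl
swap₂-odd (suc i) = ≡.cong (λ r → suc (suc r)) (swap₂-odd i)

pick-swap₂ : ∀ {a} {A : Set a} s (p q : A) → pick (swap₂ s) q p ≡ pick s p q
pick-swap₂ zero          p q = ≡.refl
pick-swap₂ (suc zero)    p q = ≡.refl
pick-swap₂ (suc (suc s)) p q = pick-swap₂ s q p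

-- The half-turn changes the pattern p q q p into q p p q q p p q. Once its first column is removed,
-- the cells group the other columns into equal pairs p p, q q; hence the constant rows of the new
-- cells.
pick-paired : ∀ {a} {A : Set a} j (p q : A) →
              pick (swap₂ (suc (suc (j ℕ.* 2)))) p q ≡ pick (swap₂ (suc (j ℕ.* 2))) p q
pick-paired zero    p q = ≡.refl
pick-paired (suc j) p q = pick-paired j q p

pick-mod : ∀ {a} {A : Set a} s (f : Fin 4 → A) → f 1F ≡ f 0F → f 2F ≡ f 3F →
           f (suc s mod 4) ≡ pick s (f 0F) (f 3F)
pick-mod 0 f eq eq′ = eq
pick-mod 1 f eq eq′ = eq′
pick-mod 2 f eq eq′ = ≡.refl
pick-mod 3 f eq eq′ = ≡.refl
pick-mod (suc (suc (suc (suc s)))) f eq eq′ = pick-mod s f eq eq′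

extend : ∀ {a} {A : Set a} → A → ∀ {k} → (Fin k → A) → ℕ → A
extend d {zero}  f r       = d
extend d {suc k} f zero    = f Fin.zero
extend d {suc k} f (suc r) = extend d (f ∘ Fin.suc) r

extend-toℕ : ∀ {a} {A : Set a} (d : A) {k} (f : Fin k → A) i → extend d f (toℕ i) ≡ f i
extend-toℕ d f Fin.zero    = ≡.refl
extend-toℕ d f (Fin.suc i) = extend-toℕ d (f ∘ Fin.suc) i

toℕ-combine-2 : ∀ {n} (i : Fin n) (a : Fin 2) → toℕ (combine i a) ≡ toℕ a ℕ.+ toℕ i ℕ.* 2
toℕ-combine-2 {n} i a = ≡.trans (toℕ-remQuot {n} (combine i a))
  (≡.cong (λ (j , b) → toℕ b ℕ.+ toℕ j ℕ.* 2) (Fin.remQuot-combine i a))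

-- Each renewal removes one edge row at the top, and only the first permutes the rows of `T`, by
-- `swap₂`. So row `r` of the final weight comes from row `swap₂ (r + 2)`, which is the row that `t`
-- reads.
toℕ-t : ∀ {m} (r : Fin (m ℕ.* 2)) → let (k , a) = remQuot {m} 2 r in
        toℕ (combine (Fin.suc (inject₁ k)) (opposite a)) ≡ suc (suc (swap₂ (toℕ r)))
toℕ-t {m} r = let (k , a) = remQuot {m} 2 r in begin
  toℕ (combine (Fin.suc (inject₁ k)) (opposite a))
    ≡⟨ toℕ-combine-2 (Fin.suc (inject₁ k)) (opposite a) ⟩
  toℕ (opposite a) ℕ.+ suc (toℕ (inject₁ k)) ℕ.* 2
    ≡⟨ ≡.cong (λ k → toℕ (opposite a) ℕ.+ suc k ℕ.* 2) (Fin.toℕ-inject₁ k) ⟩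
  toℕ (opposite a) ℕ.+ suc (toℕ k) ℕ.* 2
    ≡⟨ lemma (toℕ k) a ⟩
  suc (suc (swap₂ (toℕ a ℕ.+ toℕ k ℕ.* 2)))
    ≡⟨ ≡.cong (λ r → suc (suc (swap₂ r))) (toℕ-remQuot {m} r) ⟨
  suc (suc (swap₂ (toℕ r))) ∎
  where
  open ≡.≡-Reasoning
  lemma : ∀ k (a : Fin 2) → toℕ (opposite a) ℕ.+ suc k ℕ.* 2 ≡ suc (suc (swap₂ (toℕ a ℕ.+ k ℕ.* 2)))
  lemma k 0F = ≡.cong (λ r → suc (suc r)) (≡.sym (swap₂-even k))
  lemma k 1F = ≡.cong (λ r → suc (suc r)) (≡.sym (swap₂-odd k))

data Parity : ℕ → Set where
  even : ∀ k → Parity (k ℕ.* 2)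
  odd  : ∀ k → Parity (suc (k ℕ.* 2))

parity : ∀ n → Parity n
parity zero    = even 0
parity (suc n) with parity n
... | even k = odd k
... | odd k  = even (suc k)

-- For n = m + 1 and rows counted from 0, the excluded rows are the first odd and the last even
-- index.
keeps : ℕ → ℕ → Bool
keeps m r = not (r ≡ᵇ 1) ∧ not (r ≡ᵇ m ℕ.* 2)

keeps-even : ∀ m i → keeps m (i ℕ.* 2) ≡ not (i ≡ᵇ m)
keeps-even m i = ≡.cong₂ (λ b b′ → not b ∧ not b′) (even≢1 i) (double i m)
  where
  even≢1 : ∀ i → (i ℕ.* 2 ≡ᵇ 1) ≡ false
  even≢1 zero    = ≡.refl
  even≢1 (suc i) = ≡.refl
  double : ∀ i m → (i ℕ.* 2 ≡ᵇ m ℕ.* 2) ≡ (i ≡ᵇ m)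
  double zero    zero    = ≡.refl
  double zero    (suc m) = ≡.refl
  double (suc i) zero    = ≡.refl
  double (suc i) (suc m) = double i m

keeps-odd : ∀ m i → keeps m (suc (suc i ℕ.* 2)) ≡ true
keeps-odd m i = ≡.cong not (odd≢even (suc i) m)
  where
  odd≢even : ∀ i m → (suc (i ℕ.* 2) ≡ᵇ m ℕ.* 2) ≡ false
  odd≢even i       zero    = ≡.refl
  odd≢even zero    (suc m) = ≡.refl
  odd≢even (suc i) (suc m) = odd≢even i m

2∤1+2k : ∀ k → 2 ∤ suc (k ℕ.* 2)
2∤1+2k k (divides q eq) = go k q eq
  where
  go : ∀ k q → suc (k ℕ.* 2) ≡ q ℕ.* 2 → ⊥
  go (suc k) (suc q) eq = go k q (ℕ.suc-injective (ℕ.suc-injective eq))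

module Dimers {c ℓ} (R : CommutativeRing c ℓ) where

  open CommutativeRing R renaming (_*_ to _·_) public
  open Weighted R public
  open import Algebra.Properties.CommutativeSemigroup *-commutativeSemigroup public
    using (interchange; xy∙z≈xz∙y)
  open import Algebra.Properties.CommutativeSemigroup +-commutativeSemigroup public
    using () renaming (interchange to +-interchange)
  open import Algebra.Solver.Ring.NaturalCoefficients.Default commutativeSemiring public
    using (solve; _:+_; _:*_; _:=_; con)
  open import Relation.Binary.Reasoning.Setoid setoid public

  private variable
    ℓ₁ ℓ₂ : Level
    A : Set ℓ₁
    B : Set ℓ₂

  -- Finite sums and products over lists, bit vectors and ranges.

  ∑-cong : ∀ (xs : List A) {f g : A → Carrier} → (∀ x → f x ≈ g x) → ∑ xs f ≈ ∑ xs g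
  ∑-cong []       eq = refl
  ∑-cong (x ∷ xs) eq = +-cong (eq x) (∑-cong xs eq)

  ∏-cong : ∀ (xs : List A) {f g : A → Carrier} → (∀ x → f x ≈ g x) → ∏ xs f ≈ ∏ xs g
  ∏-cong []       eq = refl
  ∏-cong (x ∷ xs) eq = *-cong (eq x) (∏-cong xs eq)

  ∑-++ : ∀ (xs ys : List A) f → ∑ (xs ++ ys) f ≈ ∑ xs f + ∑ ys f
  ∑-++ []       ys f = sym (+-identityˡ _)
  ∑-++ (x ∷ xs) ys f = trans (+-congˡ (∑-++ xs ys f)) (sym (+-assoc _ _ _))

  ∏-++ : ∀ (xs ys : List A) f → ∏ (xs ++ ys) f ≈ ∏ xs f · ∏ ys f
  ∏-++ []       ys f = sym (*-identityˡ _)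
  ∏-++ (x ∷ xs) ys f = trans (*-congˡ (∏-++ xs ys f)) (sym (*-assoc _ _ _))

  ∑-map : ∀ (h : A → B) xs f → ∑ (map h xs) f ≡ ∑ xs (f ∘ h)
  ∑-map h []       f = ≡.refl
  ∑-map h (x ∷ xs) f = ≡.cong (f (h x) +_) (∑-map h xs f)

  ∏-map : ∀ (h : A → B) xs f → ∏ (map h xs) f ≡ ∏ xs (f ∘ h)
  ∏-map h []       f = ≡.refl
  ∏-map h (x ∷ xs) f = ≡.cong (f (h x) ·_) (∏-map h xs f)

  ∑-zero : ∀ (xs : List A) {f : A → Carrier} → (∀ x → f x ≈ 0#) → ∑ xs f ≈ 0#
  ∑-zero []       eq = refl
  ∑-zero (x ∷ xs) eq = trans (+-cong (eq x) (∑-zero xs eq)) (+-identityˡ _)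

  ∑-+ : ∀ (xs : List A) f g → ∑ xs (λ x → f x + g x) ≈ ∑ xs f + ∑ xs g
  ∑-+ []       f g = sym (+-identityˡ _)
  ∑-+ (x ∷ xs) f g = trans (+-congˡ (∑-+ xs f g)) (+-interchange _ _ _ _)

  ∑-distribˡ : ∀ (xs : List A) f c → c · ∑ xs f ≈ ∑ xs (λ x → c · f x)
  ∑-distribˡ []       f c = zeroʳ c
  ∑-distribˡ (x ∷ xs) f c = trans (distribˡ c _ _) (+-congˡ (∑-distribˡ xs f c))

  ∑-distribʳ : ∀ (xs : List A) f c → ∑ xs f · c ≈ ∑ xs (λ x → f x · c)
  ∑-distribʳ []       f c = zeroˡ c
  ∑-distribʳ (x ∷ xs) f c = trans (distribʳ c _ _) (+-congˡ (∑-distribʳ xs f c))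

  ∑-comm : ∀ (xs : List A) (ys : List B) (f : A → B → Carrier) →
           ∑ xs (λ x → ∑ ys (f x)) ≈ ∑ ys (λ y → ∑ xs (λ x → f x y))
  ∑-comm []       ys f = sym (∑-zero ys λ _ → refl)
  ∑-comm (x ∷ xs) ys f = trans (+-congˡ (∑-comm xs ys f)) (sym (∑-+ ys _ _))

  ∑-∑-distrib : ∀ (xs : List A) (ys : List B) f g →
                ∑ xs f · ∑ ys g ≈ ∑ xs (λ x → ∑ ys (λ y → f x · g y))
  ∑-∑-distrib xs ys f g =
    trans (∑-distribʳ xs f _) (∑-cong xs λ x → ∑-distribˡ ys g (f x))

  ∑-bits : ∀ k (f : Vec Bool (suc k) → Carrier) →
           ∑ (bits (suc k)) f ≈ ∑ (bits k) (f ∘ (true ∷_)) + ∑ (bits k) (f ∘ (false ∷_))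
  ∑-bits k f = trans (∑-++ (map (true ∷_) (bits k)) _ f)
    (reflexive (≡.cong₂ _+_ (∑-map (true ∷_) (bits k) f) (∑-map (false ∷_) (bits k) f)))

  ∑-bits-∁ : ∀ {k} (f : Vec Bool k → Carrier) → ∑ (bits k) (f ∘ ∁) ≈ ∑ (bits k) f
  ∑-bits-∁ {zero}  f = refl
  ∑-bits-∁ {suc k} f = begin
    ∑ (bits (suc k)) (f ∘ ∁)
      ≈⟨ ∑-bits k (f ∘ ∁) ⟩
    ∑ (bits k) (f ∘ (false ∷_) ∘ ∁) + ∑ (bits k) (f ∘ (true ∷_) ∘ ∁)
      ≈⟨ +-cong (∑-bits-∁ (f ∘ (false ∷_))) (∑-bits-∁ (f ∘ (true ∷_))) ⟩
    ∑ (bits k) (f ∘ (false ∷_)) + ∑ (bits k) (f ∘ (true ∷_))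
      ≈⟨ +-comm _ _ ⟩
    ∑ (bits k) (f ∘ (true ∷_)) + ∑ (bits k) (f ∘ (false ∷_))
      ≈⟨ ∑-bits k f ⟨
    ∑ (bits (suc k)) f ∎

  Π : ℕ → (ℕ → Carrier) → Carrier
  Π zero    f = 1#
  Π (suc n) f = f 0 · Π n (f ∘ suc)

  Π-cong : ∀ n {f g} → (∀ i → f i ≈ g i) → Π n f ≈ Π n g
  Π-cong zero    eq = refl
  Π-cong (suc n) eq = *-cong (eq 0) (Π-cong n (eq ∘ suc))

  Π-· : ∀ n f g → Π n (λ i → f i · g i) ≈ Π n f · Π n g
  Π-· zero    f g = sym (*-identityˡ _)
  Π-· (suc n) f g = trans (*-congˡ (Π-· n _ _)) (interchange _ _ _ _)

  -- Matchings of one edge row and of a stack of strips.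

  -- The weight of the at most one perfect matching of the vertices marked `true`
  -- in a path with edge weights w 0, w 1, …
  path : ∀ {k} → Vec Bool (suc k) → (ℕ → Carrier) → Carrier
  path (true ∷ [])                 w = 0#
  path (false ∷ [])                w = 1#
  path {suc k} (false ∷ b ∷ bs)    w = path (b ∷ bs) (w ∘ suc)
  path {suc k} (true ∷ true ∷ bs)  w = w 0 · path (false ∷ bs) (w ∘ suc)
  path {suc k} (true ∷ false ∷ bs) w = 0#

  path-∷ʳfalse : ∀ {k} (bs : Vec Bool (suc k)) w → path (bs ∷ʳ false) w ≈ path bs w
  path-∷ʳfalse (true ∷ [])                 w = refl
  path-∷ʳfalse (false ∷ [])                w = refl
  path-∷ʳfalse {suc k} (false ∷ b ∷ bs)    w = path-∷ʳfalse (b ∷ bs) (w ∘ suc)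
  path-∷ʳfalse {suc k} (true ∷ true ∷ bs)  w = *-congˡ (path-∷ʳfalse (false ∷ bs) (w ∘ suc))
  path-∷ʳfalse {suc k} (true ∷ false ∷ bs) w = refl

  -- An edge row is a zigzag path that starts and ends in the longer vertex row, so `V` supplies the
  -- first vertex.
  row : ∀ {n} → Vec Bool n → Vec Bool (suc n) → (ℕ → Carrier) → Carrier
  row S (b ∷ V) w = path (b ∷ interleave S V) w

  none : ∀ {n} → Vec Bool n → Carrier
  none []          = 1#
  none (true ∷ S)  = 0#
  none (false ∷ S) = none S

  row-false : ∀ {n} (S : Vec Bool n) w → row S (replicate _ false) w ≈ none S
  row-false []          w = refl
  row-false (true ∷ S)  w = refl
  row-false (false ∷ S) w = row-false S (w ∘ suc ∘ suc)

  ∑-none : ∀ {n} (f : Vec Bool n → Carrier) →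
           ∑ (bits n) (λ V → none V · f V) ≈ f (replicate n false)
  ∑-none {zero}  f = trans (+-identityʳ _) (*-identityˡ _)
  ∑-none {suc n} f = begin
    ∑ (bits (suc n)) (λ V → none V · f V)                ≈⟨ ∑-bits n _ ⟩
    ∑ (bits n) (λ V → 0# · f (true ∷ V)) + ∑ (bits n) _
      ≈⟨ +-cong (∑-zero (bits n) (λ V → zeroˡ _)) (∑-none (f ∘ (false ∷_))) ⟩
    0# + f (replicate (suc n) false)                     ≈⟨ +-identityˡ _ ⟩
    f (replicate (suc n) false)                          ∎

  -- The weighted count of the matchings of the last m strips (pairs of edge rows) that
  -- cover, of the vertices u above these strips, exactly the set S.
  partition : ∀ {n} → ℕ → (ℕ → ℕ → Carrier) → Vec Bool n → Carrier
  partition zero            w S = none S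
  partition {n} (suc m) w S =
    ∑ (bits (suc n)) λ V → ∑ (bits n) λ S′ →
      row S V (w 0) · (row S′ (∁ V) (w 1) · partition m (λ r → w (suc (suc r))) (∁ S′))

  Z : ℕ → (ℕ → ℕ → Carrier) → Carrier
  Z n w = partition n w (replicate n true)

  -- Transfer matrices of a strip.

  -- A pair of edge rows is scanned from left to right.  A vertex between them is in
  -- state `true` if the edges to its left cover it; in state `false` it is left to
  -- the edges to its right, those of the upper or those of the lower row.
  overStates : (Bool → Bool → Carrier) → Bool → Carrier
  overStates g true  = g false false
  overStates g false = g true false + g false true

  overStates-cong : ∀ {g h} e → (∀ β β′ → g β β′ ≈ h β β′) → overStates g e ≈ overStates h e
  overStates-cong true  eq = eq false false
  overStates-cong false eq = +-cong (eq true false) (eq false true)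

  overStates-∑ : ∀ (xs : List A) (h : Bool → Bool → A → Carrier) e →
                 overStates (λ β β′ → ∑ xs (h β β′)) e ≈
                 ∑ xs (λ x → overStates (λ β β′ → h β β′ x) e)
  overStates-∑ xs h true  = refl
  overStates-∑ xs h false = sym (∑-+ xs _ _)

  -- `p γ` stands for the weight of the rest of the path when its first vertex has mark `γ`. With
  -- the rest abstracted, a cell acts linearly on `p true` and `p false`.
  pathCell : (β s τ : Bool) (w₀ w₁ : Carrier) (p : Bool → Carrier) → Carrier
  pathCell false false τ     w₀ w₁ p = p τ
  pathCell true  true  τ     w₀ w₁ p = w₀ · p τ
  pathCell false true  true  w₀ w₁ p = w₁ · p false
  pathCell false true  false w₀ w₁ p = 0#
  pathCell true  false τ     w₀ w₁ p = 0#

  path-cell : ∀ {k} β s τ (bs : Vec Bool k) w →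
              path (β ∷ s ∷ τ ∷ bs) w ≡
              pathCell β s τ (w 0) (w 1) (λ γ → path (γ ∷ bs) (w ∘ suc ∘ suc))
  path-cell false false τ     bs w = ≡.refl
  path-cell true  true  τ     bs w = ≡.refl
  path-cell false true  true  bs w = ≡.refl
  path-cell false true  false bs w = ≡.refl
  path-cell true  false τ     bs w = ≡.refl

  -- The entries from state e to `false` (lo) and to `true` (hi) of the transfer matrix
  -- of a cell with weights a b in the upper and c d in the lower row; s and s′ tell
  -- whether its upper and its lower vertex are to be covered.
  lo hi : (e s s′ : Bool) (a b c d : Carrier) → Carrier
  lo false true  false a b c d = a
  lo false false true  a b c d = c
  lo true  false false a b c d = 1#
  lo _     _     _     a b c d = 0#
  hi false true  true  a b c d = a · d + b · c
  hi true  true  false a b c d = b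
  hi true  false true  a b c d = d
  hi _     _     _     a b c d = 0#

  -- The two summands give the next vertex between the rows to the upper and to the lower row. Of
  -- the rests, `p true · q false + p false · q true` belongs to this vertex being still uncovered
  -- after the cell, `p false · q false` to its being covered; the eight cases compare coefficients.
  pathCell-transfer : ∀ e s s′ a b c d (p q : Bool → Carrier) →
    overStates (λ β β′ → pathCell β s true a b p · pathCell β′ s′ false c d q
                       + pathCell β s false a b p · pathCell β′ s′ true c d q) e
    ≈ lo e s s′ a b c d · (p true · q false + p false · q true)
    + hi e s s′ a b c d · (p false · q false)
  pathCell-transfer false false false a b c d p q =
    solve 8 (λ a b c d pt pf qt qf →
      (con 0 :* qf :+ con 0 :* qt) :+ (pt :* con 0 :+ pf :* con 0)
      := con 0 :* (pt :* qf :+ pf :* qt) :+ con 0 :* (pf :* qf))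
      refl a b c d (p true) (p false) (q true) (q false)
  pathCell-transfer false false true  a b c d p q =
    solve 8 (λ a b c d pt pf qt qf →
      (con 0 :* con 0 :+ con 0 :* (d :* qf)) :+ (pt :* (c :* qf) :+ pf :* (c :* qt))
      := c :* (pt :* qf :+ pf :* qt) :+ con 0 :* (pf :* qf))
      refl a b c d (p true) (p false) (q true) (q false)
  pathCell-transfer false true  false a b c d p q =
    solve 8 (λ a b c d pt pf qt qf →
      ((a :* pt) :* qf :+ (a :* pf) :* qt) :+ ((b :* pf) :* con 0 :+ con 0 :* con 0)
      := a :* (pt :* qf :+ pf :* qt) :+ con 0 :* (pf :* qf))
      refl a b c d (p true) (p false) (q true) (q false)
  pathCell-transfer false true  true  a b c d p q =
    solve 8 (λ a b c d pt pf qt qf →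
      ((a :* pt) :* con 0 :+ (a :* pf) :* (d :* qf)) :+ ((b :* pf) :* (c :* qf) :+ con 0 :* (c :* qt))
      := con 0 :* (pt :* qf :+ pf :* qt) :+ (a :* d :+ b :* c) :* (pf :* qf))
      refl a b c d (p true) (p false) (q true) (q false)
  pathCell-transfer true  false false a b c d p q =
    solve 8 (λ a b c d pt pf qt qf →
      pt :* qf :+ pf :* qt
      := con 1 :* (pt :* qf :+ pf :* qt) :+ con 0 :* (pf :* qf))
      refl a b c d (p true) (p false) (q true) (q false)
  pathCell-transfer true  false true  a b c d p q =
    solve 8 (λ a b c d pt pf qt qf →
      pt :* con 0 :+ pf :* (d :* qf)
      := con 0 :* (pt :* qf :+ pf :* qt) :+ d :* (pf :* qf))
      refl a b c d (p true) (p false) (q true) (q false)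
  pathCell-transfer true  true  false a b c d p q =
    solve 8 (λ a b c d pt pf qt qf →
      (b :* pf) :* qf :+ con 0 :* qt
      := con 0 :* (pt :* qf :+ pf :* qt) :+ b :* (pf :* qf))
      refl a b c d (p true) (p false) (q true) (q false)
  pathCell-transfer true  true  true  a b c d p q =
    solve 8 (λ a b c d pt pf qt qf →
      (b :* pf) :* con 0 :+ con 0 :* (d :* qf)
      := con 0 :* (pt :* qf :+ pf :* qt) :+ con 0 :* (pf :* qf))
      refl a b c d (p true) (p false) (q true) (q false)

  transfer : ∀ {n} → (Bool → Carrier) → Bool → Vec Bool n → Vec Bool n → (w₀ w₁ : ℕ → Carrier) → Carrier
  transfer end e []      []        w₀ w₁ = end e
  transfer end e (s ∷ S) (s′ ∷ S′) w₀ w₁ =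
    lo e s s′ (w₀ 0) (w₀ 1) (w₁ 0) (w₁ 1) · transfer end false S S′ (w₀ ∘ suc ∘ suc) (w₁ ∘ suc ∘ suc)
    + hi e s s′ (w₀ 0) (w₀ 1) (w₁ 0) (w₁ 1) · transfer end true S S′ (w₀ ∘ suc ∘ suc) (w₁ ∘ suc ∘ suc)

  paths : ∀ {k l n} → (Vec Bool n → Vec Bool k) → (Vec Bool n → Vec Bool l) →
          (w₀ w₁ : ℕ → Carrier) → Bool → Bool → Carrier
  paths {n = n} f g w₀ w₁ β β′ = ∑ (bits n) λ V → path (β ∷ f V) w₀ · path (β′ ∷ g V) w₁

  paths-step : ∀ {k l n} (F : Vec Bool n → Vec Bool k) (G : Vec Bool n → Vec Bool l) s s′ w₀ w₁ e →
    overStates (paths {n = suc n} (λ V → s ∷ Vec.head V ∷ F (Vec.tail V))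
                                  (λ V → s′ ∷ not (Vec.head V) ∷ G (Vec.tail V)) w₀ w₁) e
    ≈ lo e s s′ (w₀ 0) (w₀ 1) (w₁ 0) (w₁ 1) · overStates (paths F G (w₀ ∘ suc ∘ suc) (w₁ ∘ suc ∘ suc)) false
    + hi e s s′ (w₀ 0) (w₀ 1) (w₁ 0) (w₁ 1) · overStates (paths F G (w₀ ∘ suc ∘ suc) (w₁ ∘ suc ∘ suc)) true
  paths-step {n = n} F G s s′ w₀ w₁ e = begin
    overStates (paths f′ g′ w₀ w₁) e
      ≈⟨ overStates-cong e (λ β β′ → trans (∑-bits n _) (sym (∑-+ (bits n) _ _))) ⟩
    overStates (λ β β′ → ∑ (bits n) λ V → path (β ∷ f′ (true ∷ V)) w₀ · path (β′ ∷ g′ (true ∷ V)) w₁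
                                      + path (β ∷ f′ (false ∷ V)) w₀ · path (β′ ∷ g′ (false ∷ V)) w₁) e
      ≈⟨ overStates-∑ (bits n) _ e ⟩
    ∑ (bits n) (λ V → overStates (λ β β′ → path (β ∷ f′ (true ∷ V)) w₀ · path (β′ ∷ g′ (true ∷ V)) w₁
                                      + path (β ∷ f′ (false ∷ V)) w₀ · path (β′ ∷ g′ (false ∷ V)) w₁) e)
      ≈⟨ ∑-cong (bits n) (λ V → trans
           (overStates-cong e λ β β′ → reflexive (≡.cong₂ _+_
             (≡.cong₂ _·_ (path-cell β s true (F V) w₀) (path-cell β′ s′ false (G V) w₁))
             (≡.cong₂ _·_ (path-cell β s false (F V) w₀) (path-cell β′ s′ true (G V) w₁))))
           (pathCell-transfer e s s′ (w₀ 0) (w₀ 1) (w₁ 0) (w₁ 1) (p V) (q V))) ⟩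
    ∑ (bits n) (λ V → l · (p V true · q V false + p V false · q V true) + h · (p V false · q V false))
      ≈⟨ ∑-+ (bits n) _ _ ⟩
    ∑ (bits n) (λ V → l · (p V true · q V false + p V false · q V true))
      + ∑ (bits n) (λ V → h · (p V false · q V false))
      ≈⟨ +-cong (∑-distribˡ (bits n) _ l) (∑-distribˡ (bits n) _ h) ⟨
    l · ∑ (bits n) (λ V → p V true · q V false + p V false · q V true)
      + h · ∑ (bits n) (λ V → p V false · q V false)
      ≈⟨ +-congʳ (*-congˡ (∑-+ (bits n) _ _)) ⟩
    l · overStates (paths F G (w₀ ∘ suc ∘ suc) (w₁ ∘ suc ∘ suc)) false
      + h · overStates (paths F G (w₀ ∘ suc ∘ suc) (w₁ ∘ suc ∘ suc)) true ∎
    where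
    f′ : Vec Bool (suc n) → _
    f′ V = s ∷ Vec.head V ∷ F (Vec.tail V)
    g′ : Vec Bool (suc n) → _
    g′ V = s′ ∷ not (Vec.head V) ∷ G (Vec.tail V)
    p q : Vec Bool n → Bool → Carrier
    p V γ = path (γ ∷ F V) (w₀ ∘ suc ∘ suc)
    q V γ = path (γ ∷ G V) (w₁ ∘ suc ∘ suc)
    l = lo e s s′ (w₀ 0) (w₀ 1) (w₁ 0) (w₁ 1)
    h = hi e s s′ (w₀ 0) (w₀ 1) (w₁ 0) (w₁ 1)

  paths-cong : ∀ {k l n} {f f′ : Vec Bool n → Vec Bool k} {g g′ : Vec Bool n → Vec Bool l} →
               (∀ V → f V ≡ f′ V) → (∀ V → g V ≡ g′ V) → ∀ w₀ w₁ β β′ →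
               paths f g w₀ w₁ β β′ ≈ paths f′ g′ w₀ w₁ β β′
  paths-cong {n = n} f≗f′ g≗g′ w₀ w₁ β β′ = ∑-cong (bits n) λ V →
    reflexive (≡.cong₂ (λ bs bs′ → path (β ∷ bs) w₀ · path (β′ ∷ bs′) w₁) (f≗f′ V) (g≗g′ V))

  ⟦_⟧ : Bool → Carrier
  ⟦ b ⟧ = if b then 1# else 0#

  -- The step common to both boundary conditions. On `τ ∷ V` the interleavings unfold by
  -- computation, with or without a final `false`, so the two equations on `f` and `g` will hold by
  -- `refl`.
  transfer-step : ∀ {k l n} (F : Vec Bool n → Vec Bool k) (G : Vec Bool n → Vec Bool l) {end m}
    (S S′ : Vec Bool m) →
    (∀ w₀ w₁ e → overStates (paths F G w₀ w₁) e ≈ transfer end e S S′ w₀ w₁) →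
    ∀ {s s′} {f : Vec Bool (suc n) → Vec Bool (suc (suc k))} {g : Vec Bool (suc n) → Vec Bool (suc (suc l))} →
    (∀ τ V → f (τ ∷ V) ≡ s ∷ τ ∷ F V) → (∀ τ V → g (τ ∷ V) ≡ s′ ∷ not τ ∷ G V) →
    ∀ w₀ w₁ e → overStates (paths f g w₀ w₁) e ≈ transfer end e (s ∷ S) (s′ ∷ S′) w₀ w₁
  transfer-step {n = n} F G S S′ rec {s} {s′} {f} {g} eqf eqg w₀ w₁ e = begin
    overStates (paths f g w₀ w₁) e
      ≈⟨ overStates-cong e (paths-cong {n = suc n} (λ { (τ ∷ V) → eqf τ V }) (λ { (τ ∷ V) → eqg τ V }) w₀ w₁) ⟩
    overStates (paths (λ V → s ∷ Vec.head V ∷ F (Vec.tail V))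
                      (λ V → s′ ∷ not (Vec.head V) ∷ G (Vec.tail V)) w₀ w₁) e
      ≈⟨ paths-step F G s s′ w₀ w₁ e ⟩
    _ ≈⟨ +-cong (*-congˡ (rec (w₀ ∘ suc ∘ suc) (w₁ ∘ suc ∘ suc) false))
                (*-congˡ (rec (w₀ ∘ suc ∘ suc) (w₁ ∘ suc ∘ suc) true)) ⟩
    transfer _ e (s ∷ S) (s′ ∷ S′) w₀ w₁ ∎

  open-transfer : ∀ {n} (S S′ : Vec Bool n) w₀ w₁ e →
    overStates (paths (interleave S) (interleave S′ ∘ ∁) w₀ w₁) e ≈ transfer ⟦_⟧ e S S′ w₀ w₁
  open-transfer [] [] w₀ w₁ true  = trans (+-identityʳ _) (*-identityˡ _)
  open-transfer [] [] w₀ w₁ false =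
    solve 0 ((con 0 :* con 1 :+ con 0) :+ (con 1 :* con 0 :+ con 0) := con 0) refl
  open-transfer (s ∷ S) (s′ ∷ S′) =
    transfer-step (interleave S) (interleave S′ ∘ ∁) S S′ (open-transfer S S′)
      (λ _ _ → ≡.refl) (λ _ _ → ≡.refl)

  -- Appending `false` to both `V` and `∁ V`, instead of complementing the longer vector, takes the
  -- last vertex away from both rows. The final state must then be `false`, whereas the open strip
  -- demands `true`.
  closed-transfer : ∀ {n} (S S′ : Vec Bool (suc n)) w₀ w₁ e →
    overStates (paths (λ V → interleave S (V ∷ʳ false)) (λ V → interleave S′ (∁ V ∷ʳ false)) w₀ w₁) e
    ≈ transfer (⟦_⟧ ∘ not) e S S′ w₀ w₁
  closed-transfer (s ∷ s₁ ∷ S) (s′ ∷ s₁′ ∷ S′) =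
    transfer-step (λ V → interleave (s₁ ∷ S) (V ∷ʳ false)) (λ V → interleave (s₁′ ∷ S′) (∁ V ∷ʳ false))
      (s₁ ∷ S) (s₁′ ∷ S′) (closed-transfer (s₁ ∷ S) (s₁′ ∷ S′)) (λ _ _ → ≡.refl) (λ _ _ → ≡.refl)
  closed-transfer (false ∷ []) (false ∷ []) w₀ w₁ false =
    solve 4 (λ a b c d → (con 0 :* con 1 :+ con 0) :+ (con 1 :* con 0 :+ con 0)
                      := con 0 :* con 1 :+ con 0 :* con 0)
      refl (w₀ 0) (w₀ 1) (w₁ 0) (w₁ 1)
  closed-transfer (false ∷ []) (true ∷ []) w₀ w₁ false =
    solve 4 (λ a b c d → (con 0 :* con 0 :+ con 0) :+ (con 1 :* (c :* con 1) :+ con 0)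
                      := c :* con 1 :+ con 0 :* con 0)
      refl (w₀ 0) (w₀ 1) (w₁ 0) (w₁ 1)
  closed-transfer (true ∷ []) (false ∷ []) w₀ w₁ false =
    solve 4 (λ a b c d → ((a :* con 1) :* con 1 :+ con 0) :+ (con 0 :* con 0 :+ con 0)
                      := a :* con 1 :+ con 0 :* con 0)
      refl (w₀ 0) (w₀ 1) (w₁ 0) (w₁ 1)
  closed-transfer (true ∷ []) (true ∷ []) w₀ w₁ false =
    solve 4 (λ a b c d → ((a :* con 1) :* con 0 :+ con 0) :+ (con 0 :* (c :* con 1) :+ con 0)
                      := con 0 :* con 1 :+ (a :* d :+ b :* c) :* con 0)
      refl (w₀ 0) (w₀ 1) (w₁ 0) (w₁ 1)
  closed-transfer (false ∷ []) (false ∷ []) w₀ w₁ true =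
    solve 4 (λ a b c d → con 1 :* con 1 :+ con 0
                      := con 1 :* con 1 :+ con 0 :* con 0)
      refl (w₀ 0) (w₀ 1) (w₁ 0) (w₁ 1)
  closed-transfer (false ∷ []) (true ∷ []) w₀ w₁ true =
    solve 4 (λ a b c d → con 1 :* con 0 :+ con 0
                      := con 0 :* con 1 :+ d :* con 0)
      refl (w₀ 0) (w₀ 1) (w₁ 0) (w₁ 1)
  closed-transfer (true ∷ []) (false ∷ []) w₀ w₁ true =
    solve 4 (λ a b c d → con 0 :* con 1 :+ con 0
                      := con 0 :* con 1 :+ b :* con 0)
      refl (w₀ 0) (w₀ 1) (w₁ 0) (w₁ 1)
  closed-transfer (true ∷ []) (true ∷ []) w₀ w₁ true =
    solve 4 (λ a b c d → con 0 :* con 0 :+ con 0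
                      := con 0 :* con 1 :+ con 0 :* con 0)
      refl (w₀ 0) (w₀ 1) (w₁ 0) (w₁ 1)

  -- Urban renewal of a strip.

  -- Division-free urban renewal: the cell a b / c d is ω times the half-turn of the
  -- cell a* b* / c* d*, and ad + bc = δ ω with δ the same for all cells of the strip.
  record Dual (w₀ w₁ w₀* w₁* ω : ℕ → Carrier) (δ : Carrier) : Set ℓ where
    field
      a≈ωd* : ∀ j → w₀ (j ℕ.* 2) ≈ ω j · w₁* (suc (j ℕ.* 2))
      b≈ωc* : ∀ j → w₀ (suc (j ℕ.* 2)) ≈ ω j · w₁* (j ℕ.* 2)
      c≈ωb* : ∀ j → w₁ (j ℕ.* 2) ≈ ω j · w₀* (suc (j ℕ.* 2))
      d≈ωa* : ∀ j → w₁ (suc (j ℕ.* 2)) ≈ ω j · w₀* (j ℕ.* 2)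
      aa*+bb*≈δ : ∀ j → w₀ (j ℕ.* 2) · w₀* (j ℕ.* 2) + w₀ (suc (j ℕ.* 2)) · w₀* (suc (j ℕ.* 2)) ≈ δ

  open Dual

  Dual-shift : ∀ {w₀ w₁ w₀* w₁* ω δ} → Dual w₀ w₁ w₀* w₁* ω δ →
    Dual (w₀ ∘ suc ∘ suc) (w₁ ∘ suc ∘ suc) (w₀* ∘ suc ∘ suc) (w₁* ∘ suc ∘ suc) (ω ∘ suc) δ
  Dual-shift D = record
    { a≈ωd* = a≈ωd* D ∘ suc ; b≈ωc* = b≈ωc* D ∘ suc ; c≈ωb* = c≈ωb* D ∘ suc
    ; d≈ωa* = d≈ωa* D ∘ suc ; aa*+bb*≈δ = aa*+bb*≈δ D ∘ suc }

  scale : Carrier → Bool → Carrier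
  scale δ e = if e then 1# else δ

  module _ {a b c d a* b* c* d* ω δ : Carrier} (a≈ : a ≈ ω · d*) (b≈ : b ≈ ω · c*)
           (c≈ : c ≈ ω · b*) (d≈ : d ≈ ω · a*) (δ≈ : a · a* + b · b* ≈ δ) where

    -- This and `δ≈ω[a*d*+b*c*]` follow from aa* + bb* = δ by substitution. From ad + bc = δ ω the
    -- second would need ω to be cancelled; hence the form of the field `aa*+bb*≈δ`.
    ad+bc≈δω : a · d + b · c ≈ δ · ω
    ad+bc≈δω = begin
      a · d + b · c               ≈⟨ +-cong (*-congˡ d≈) (*-congˡ c≈) ⟩
      a · (ω · a*) + b · (ω · b*)
        ≈⟨ solve 5 (λ a b a* b* ω → a :* (ω :* a*) :+ b :* (ω :* b*) := (a :* a* :+ b :* b*) :* ω)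
             refl a b a* b* ω ⟩
      (a · a* + b · b*) · ω       ≈⟨ *-congʳ δ≈ ⟩
      δ · ω                       ∎

    δ≈ω[a*d*+b*c*] : δ ≈ ω · (a* · d* + b* · c*)
    δ≈ω[a*d*+b*c*] = begin
      δ                             ≈⟨ δ≈ ⟨
      a · a* + b · b*               ≈⟨ +-cong (*-congʳ a≈) (*-congʳ b≈) ⟩
      ω · d* · a* + ω · c* · b*
        ≈⟨ solve 5 (λ a* b* c* d* ω → ω :* d* :* a* :+ ω :* c* :* b* := ω :* (a* :* d* :+ b* :* c*))
             refl a* b* c* d* ω ⟩
      ω · (a* · d* + b* · c*)       ∎

    -- The diagonal gauge `scale δ`, moved across rather than inverted. Together with `hi-dual`: an
    -- entry from `e` to `e′` times `scale δ e′` is `scale δ e · ω` times the dual entry from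
    -- `not e` to `not e′`. The factor δ on the left is supplied in `transfer-dual` by the rest of
    -- the strip, scanned from state `false`.
    lo-dual : ∀ e s s′ → lo e s s′ a b c d · δ ≈ scale δ e · (ω · hi (not e) (not s) (not s′) a* b* c* d*)
    lo-dual false false false = trans (zeroˡ _) (sym (trans (*-congˡ (zeroʳ _)) (zeroʳ _)))
    lo-dual false true  true  = trans (zeroˡ _) (sym (trans (*-congˡ (zeroʳ _)) (zeroʳ _)))
    lo-dual false true  false = trans (*-comm _ _) (*-congˡ a≈)
    lo-dual false false true  = trans (*-comm _ _) (*-congˡ c≈)
    lo-dual true  false false = *-congˡ δ≈ω[a*d*+b*c*]
    lo-dual true  false true  = trans (zeroˡ _) (sym (trans (*-congˡ (zeroʳ _)) (zeroʳ _)))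
    lo-dual true  true  false = trans (zeroˡ _) (sym (trans (*-congˡ (zeroʳ _)) (zeroʳ _)))
    lo-dual true  true  true  = trans (zeroˡ _) (sym (trans (*-congˡ (zeroʳ _)) (zeroʳ _)))

    hi-dual : ∀ e s s′ → hi e s s′ a b c d ≈ scale δ e · (ω · lo (not e) (not s) (not s′) a* b* c* d*)
    hi-dual false true  true  = trans ad+bc≈δω (*-congˡ (sym (*-identityʳ _)))
    hi-dual false false false = sym (trans (*-congˡ (zeroʳ _)) (zeroʳ _))
    hi-dual false true  false = sym (trans (*-congˡ (zeroʳ _)) (zeroʳ _))
    hi-dual false false true  = sym (trans (*-congˡ (zeroʳ _)) (zeroʳ _))
    hi-dual true  true  false = trans b≈ (sym (*-identityˡ _))
    hi-dual true  false true  = trans d≈ (sym (*-identityˡ _))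
    hi-dual true  false false = sym (trans (*-congˡ (zeroʳ _)) (zeroʳ _))
    hi-dual true  true  true  = sym (trans (*-congˡ (zeroʳ _)) (zeroʳ _))

  -- A path from state `false` to state `true` makes one more step up than down, which
  -- accounts for the single factor δ.
  transfer-dual : ∀ {n} (S S′ : Vec Bool n) {w₀ w₁ w₀* w₁* ω δ} → Dual w₀ w₁ w₀* w₁* ω δ → ∀ e →
    transfer ⟦_⟧ e S S′ w₀ w₁
    ≈ scale δ e · (Π n ω · transfer (⟦_⟧ ∘ not) (not e) (∁ S) (∁ S′) w₀* w₁*)
  transfer-dual [] [] D true  = sym (trans (*-identityˡ _) (*-identityˡ _))
  transfer-dual [] [] D false = sym (trans (*-congˡ (*-identityˡ _)) (zeroʳ _))
  transfer-dual {suc n} (s ∷ S) (s′ ∷ S′) {w₀} {w₁} {w₀*} {w₁*} {ω} {δ} D e = begin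
    l · transfer _ false S S′ _ _ + h · transfer _ true S S′ _ _
      ≈⟨ +-cong (*-congˡ (transfer-dual S S′ (Dual-shift D) false))
                (*-congˡ (transfer-dual S S′ (Dual-shift D) true)) ⟩
    l · (δ · (P · t₁)) + h · (1# · (P · t₀))
      ≈⟨ solve 6 (λ l h δ P t₀ t₁ → l :* (δ :* (P :* t₁)) :+ h :* (con 1 :* (P :* t₀))
                                 := l :* δ :* (P :* t₁) :+ h :* (P :* t₀)) refl l h δ P t₀ t₁ ⟩
    l · δ · (P · t₁) + h · (P · t₀)
      ≈⟨ +-cong (*-congʳ (lo-dual (a≈ωd* D 0) (b≈ωc* D 0) (c≈ωb* D 0) (d≈ωa* D 0) (aa*+bb*≈δ D 0) e s s′))
                (*-congʳ (hi-dual (a≈ωd* D 0) (b≈ωc* D 0) (c≈ωb* D 0) (d≈ωa* D 0) (aa*+bb*≈δ D 0) e s s′)) ⟩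
    scale δ e · (ω 0 · h*) · (P · t₁) + scale δ e · (ω 0 · l*) · (P · t₀)
      ≈⟨ solve 7 (λ κ ω h* l* P t₀ t₁ → κ :* (ω :* h*) :* (P :* t₁) :+ κ :* (ω :* l*) :* (P :* t₀)
                                    := κ :* (ω :* P :* (l* :* t₀ :+ h* :* t₁)))
           refl (scale δ e) (ω 0) h* l* P t₀ t₁ ⟩
    scale δ e · (ω 0 · P · (l* · t₀ + h* · t₁)) ∎
    where
    P l h l* h* t₀ t₁ : Carrier
    P  = Π n (ω ∘ suc)
    l  = lo e s s′ (w₀ 0) (w₀ 1) (w₁ 0) (w₁ 1)
    h  = hi e s s′ (w₀ 0) (w₀ 1) (w₁ 0) (w₁ 1)
    l* = lo (not e) (not s) (not s′) (w₀* 0) (w₀* 1) (w₁* 0) (w₁* 1)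
    h* = hi (not e) (not s) (not s′) (w₀* 0) (w₀* 1) (w₁* 0) (w₁* 1)
    t₀ = transfer (⟦_⟧ ∘ not) false (∁ S) (∁ S′) (w₀* ∘ suc ∘ suc) (w₁* ∘ suc ∘ suc)
    t₁ = transfer (⟦_⟧ ∘ not) true (∁ S) (∁ S′) (w₀* ∘ suc ∘ suc) (w₁* ∘ suc ∘ suc)

  -- End vertices marked `false` make the first and the last edge unusable. What remains starts and
  -- ends in `T`, so `T` becomes the longer vertex row: u and v exchange roles.
  path-closed : ∀ {n} (T : Vec Bool (suc n)) (V : Vec Bool n) (w : ℕ → Carrier) →
                path (false ∷ interleave T (V ∷ʳ false)) w ≈ row V T (w ∘ suc)
  path-closed (b ∷ T) V w = trans
    (reflexive (≡.cong (λ bs → path (false ∷ bs) w) (interleave-∷ʳ (b ∷ T) V false)))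
    (path-∷ʳfalse (b ∷ interleave V T) (w ∘ suc))

  -- When all `n + 2` vertices between the rows are covered, the scan runs from `false` to `true`.
  -- The complementary scan runs from `true` to `false`: the two outermost vertices are out of play
  -- and `n` remain.
  strip-dual : ∀ {n} (S S′ : Vec Bool (suc n)) {w₀ w₁ w₀* w₁* ω : ℕ → Carrier} {δ : Carrier} → Dual w₀ w₁ w₀* w₁* ω δ →
    ∑ (bits (suc (suc n))) (λ V → row S V w₀ · row S′ (∁ V) w₁)
    ≈ δ · (Π (suc n) ω ·
        ∑ (bits n) (λ V → row V (∁ S) (w₀* ∘ suc) · row (∁ V) (∁ S′) (w₁* ∘ suc)))
  strip-dual {n} S S′ {w₀} {w₁} {w₀*} {w₁*} {ω} {δ} D = begin
    ∑ (bits (suc (suc n))) (λ V → row S V w₀ · row S′ (∁ V) w₁)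
      ≈⟨ ∑-bits (suc n) _ ⟩
    overStates (paths (interleave S) (interleave S′ ∘ ∁) w₀ w₁) false
      ≈⟨ open-transfer S S′ w₀ w₁ false ⟩
    transfer ⟦_⟧ false S S′ w₀ w₁
      ≈⟨ transfer-dual S S′ D false ⟩
    δ · (Π (suc n) ω · transfer (⟦_⟧ ∘ not) true (∁ S) (∁ S′) w₀* w₁*)
      ≈⟨ *-congˡ (*-congˡ (closed-transfer (∁ S) (∁ S′) w₀* w₁* true)) ⟨
    δ · (Π (suc n) ω · ∑ (bits n) (λ V → path (false ∷ interleave (∁ S) (V ∷ʳ false)) w₀*
                                      · path (false ∷ interleave (∁ S′) (∁ V ∷ʳ false)) w₁*))
      ≈⟨ *-congˡ (*-congˡ (∑-cong (bits n) λ V →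
           *-cong (path-closed (∁ S) V w₀*) (path-closed (∁ S′) (∁ V) w₁*))) ⟩
    δ · (Π (suc n) ω ·
        ∑ (bits n) (λ V → row V (∁ S) (w₀* ∘ suc) · row (∁ V) (∁ S′) (w₁* ∘ suc))) ∎

  -- The weighted count on the dual edges alone, with the vertex set T above the strips
  -- complementary to the S of `partition`.
  dualPartition : ∀ {n} → ℕ → (ℕ → ℕ → Carrier) → Vec Bool (suc n) → Carrier
  dualPartition     zero    w T = none (∁ T)
  dualPartition {n} (suc m) w T =
    ∑ (bits (suc n)) λ T′ →
      ∑ (bits n) (λ V → row V T (w 0) · row (∁ V) T′ (w 1))
      · dualPartition m (w ∘ suc ∘ suc) (∁ T′)

  -- Two adjacent strips cover complementary sets `S′` and `∁ S′` of their common vertex row.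
  -- Renewal complements both, so they remain complementary and all strips can be renewed together.
  partition-dual : ∀ {n} m {w w* ω : ℕ → ℕ → Carrier} {δ : ℕ → Carrier} →
    (∀ i → Dual (w (i ℕ.* 2)) (w (suc (i ℕ.* 2))) (w* (i ℕ.* 2)) (w* (suc (i ℕ.* 2))) (ω i) (δ i)) →
    (S : Vec Bool (suc n)) →
    partition m w S
    ≈ Π m δ · (Π m (λ i → Π (suc n) (ω i)) · dualPartition m (λ r → w* r ∘ suc) (∁ S))
  partition-dual zero D S =
    sym (trans (*-identityˡ _) (trans (*-identityˡ _) (reflexive (≡.cong none (∁-involutive S)))))
  partition-dual {n} (suc m) {w} {w*} {ω} {δ} D S = begin
    ∑ (bits (suc (suc n))) (λ V → ∑ (bits (suc n)) λ S′ →
      row S V (w 0) · (row S′ (∁ V) (w 1) · partition m w″ (∁ S′)))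
      ≈⟨ ∑-comm (bits (suc (suc n))) (bits (suc n)) _ ⟩
    ∑ (bits (suc n)) (λ S′ → ∑ (bits (suc (suc n))) λ V →
      row S V (w 0) · (row S′ (∁ V) (w 1) · partition m w″ (∁ S′)))
      ≈⟨ ∑-cong (bits (suc n)) (λ S′ → trans
           (∑-cong (bits (suc (suc n))) λ V → sym (*-assoc _ _ _))
           (sym (∑-distribʳ (bits (suc (suc n))) _ _))) ⟩
    ∑ (bits (suc n)) (λ S′ →
      ∑ (bits (suc (suc n))) (λ V → row S V (w 0) · row S′ (∁ V) (w 1)) · partition m w″ (∁ S′))
      ≈⟨ ∑-cong (bits (suc n)) (λ S′ →
           *-cong (strip-dual S S′ (D 0)) (partition-dual m {w* = w* ∘ suc ∘ suc} {ω = ω ∘ suc} (D ∘ suc) (∁ S′))) ⟩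
    ∑ (bits (suc n)) (λ S′ → (δ 0 · (Π (suc n) (ω 0) · rowPair (∁ S′)))
                           · (Δs · (Ωs · dualPartition m v″ (∁ (∁ S′)))))
      ≈⟨ ∑-cong (bits (suc n)) (λ S′ →
           solve 6 (λ d o k Δ Ω p → (d :* (o :* k)) :* (Δ :* (Ω :* p)) := (d :* Δ) :* (o :* Ω) :* (k :* p))
             refl (δ 0) (Π (suc n) (ω 0)) (rowPair (∁ S′)) Δs Ωs (dualPartition m v″ (∁ (∁ S′)))) ⟩
    ∑ (bits (suc n)) (λ S′ → (δ 0 · Δs) · (Π (suc n) (ω 0) · Ωs)
                           · (rowPair (∁ S′) · dualPartition m v″ (∁ (∁ S′))))
      ≈⟨ ∑-distribˡ (bits (suc n)) _ _ ⟨
    (δ 0 · Δs) · (Π (suc n) (ω 0) · Ωs)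
      · ∑ (bits (suc n)) (λ S′ → rowPair (∁ S′) · dualPartition m v″ (∁ (∁ S′)))
      ≈⟨ *-congˡ (∑-bits-∁ (λ T′ → rowPair T′ · dualPartition m v″ (∁ T′))) ⟩
    (δ 0 · Δs) · (Π (suc n) (ω 0) · Ωs)
      · ∑ (bits (suc n)) (λ T′ → rowPair T′ · dualPartition m v″ (∁ T′))
      ≈⟨ *-assoc _ _ _ ⟩
    (δ 0 · Δs) · ((Π (suc n) (ω 0) · Ωs)
      · ∑ (bits (suc n)) (λ T′ → rowPair T′ · dualPartition m v″ (∁ T′))) ∎
    where
    w″ v″ : ℕ → ℕ → Carrier
    w″ r = w (suc (suc r))
    v″ r = w* (suc (suc r)) ∘ suc
    Δs Ωs : Carrier
    Δs = Π m (δ ∘ suc)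
    Ωs = Π m (λ i → Π (suc n) (ω (suc i)))
    rowPair : Vec Bool (suc n) → Carrier
    rowPair T′ = ∑ (bits n) λ V → row V (∁ S) (w* 0 ∘ suc) · row (∁ V) T′ (w* 1 ∘ suc)

  -- Used at the bottom of the diamond: there the vertices were all covered, so after
  -- complementation none is available and the last edge row is unusable.
  ∑-row-none : ∀ {n} (S : Vec Bool n) w →
               ∑ (bits (suc n)) (λ V → row S V w · none V) ≈ none S
  ∑-row-none {n} S w = begin
    ∑ (bits (suc n)) (λ V → row S V w · none V) ≈⟨ ∑-cong (bits (suc n)) (λ V → *-comm _ _) ⟩
    ∑ (bits (suc n)) (λ V → none V · row S V w) ≈⟨ ∑-none {suc n} (λ V → row S V w) ⟩
    row S (replicate _ false) w                 ≈⟨ row-false S w ⟩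
    none S                                      ∎

  -- Pairing each edge row with the next one instead of the previous one exchanges
  -- the roles of u and v and leaves the strips of the smaller Aztec diamond.
  dualPartition-regroup : ∀ {n} m (w : ℕ → ℕ → Carrier) (T : Vec Bool (suc n)) →
    dualPartition (suc m) w T ≈ ∑ (bits n) (λ V → row V T (w 0) · partition m (w ∘ suc) (∁ V))
  dualPartition-regroup {n} m w T = begin
    ∑ (bits (suc n)) (λ T′ →
      ∑ (bits n) (λ V → row V T (w 0) · row (∁ V) T′ (w 1)) · rest T′)
      ≈⟨ ∑-cong (bits (suc n)) (λ T′ → trans (∑-distribʳ (bits n) _ _)
           (∑-cong (bits n) λ V → *-assoc _ _ _)) ⟩
    ∑ (bits (suc n)) (λ T′ → ∑ (bits n) λ V → row V T (w 0) · (row (∁ V) T′ (w 1) · rest T′))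
      ≈⟨ ∑-comm (bits (suc n)) (bits n) _ ⟩
    ∑ (bits n) (λ V → ∑ (bits (suc n)) λ T′ → row V T (w 0) · (row (∁ V) T′ (w 1) · rest T′))
      ≈⟨ ∑-cong (bits n) (λ V → trans (sym (∑-distribˡ (bits (suc n)) _ _)) (*-congˡ (lower m w (∁ V)))) ⟩
    ∑ (bits n) (λ V → row V T (w 0) · partition m (w ∘ suc) (∁ V)) ∎
    where
    rest : Vec Bool (suc n) → Carrier
    rest T′ = dualPartition m (w ∘ suc ∘ suc) (∁ T′)
    lower : ∀ m (w : ℕ → ℕ → Carrier) (V : Vec Bool n) →
      ∑ (bits (suc n)) (λ T′ → row V T′ (w 1) · dualPartition m (w ∘ suc ∘ suc) (∁ T′))
      ≈ partition m (w ∘ suc) V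
    lower zero w V = trans
      (∑-cong (bits (suc n)) λ T′ → *-congˡ (reflexive (≡.cong none (∁-involutive T′))))
      (∑-row-none V (w 1))
    lower (suc m) w V = ∑-cong (bits (suc n)) λ T′ → trans
      (*-congˡ (dualPartition-regroup m (w ∘ suc ∘ suc) (∁ T′)))
      (∑-distribˡ (bits n) _ _)

  -- The full set at the top becomes empty under complementation, so the first edge row is unusable
  -- just like the last. The outer columns are already gone, and the removal of the border shifts
  -- both indices of `w*` by one.
  Z-dual : ∀ n {w w* ω : ℕ → ℕ → Carrier} {δ : ℕ → Carrier} →
    (∀ i → Dual (w (i ℕ.* 2)) (w (suc (i ℕ.* 2))) (w* (i ℕ.* 2)) (w* (suc (i ℕ.* 2))) (ω i) (δ i)) →
    Z (suc n) w ≈ Π (suc n) δ · (Π (suc n) (λ i → Π (suc n) (ω i)) · Z n (λ r s → w* (suc r) (suc s)))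
  Z-dual n {w} {w*} {ω} D =
    trans (partition-dual {n} (suc n) {w} {w*} {ω} D (replicate (suc n) true)) (*-congˡ (*-congˡ (begin
    dualPartition (suc n) v′ (∁ (replicate (suc n) true))
      ≈⟨ dualPartition-regroup n v′ (∁ (replicate (suc n) true)) ⟩
    ∑ (bits n) (λ V → row V (∁ (replicate (suc n) true)) (v′ 0) · partition n (v′ ∘ suc) (∁ V))
      ≈⟨ ∑-cong (bits n) (λ V → *-congʳ (trans
           (reflexive (≡.cong (λ T → row V T (v′ 0)) (Vec.map-replicate not true (suc n))))
           (row-false V (v′ 0)))) ⟩
    ∑ (bits n) (λ V → none V · partition n (v′ ∘ suc) (∁ V))
      ≈⟨ ∑-none {n} (λ V → partition n (v′ ∘ suc) (∁ V)) ⟩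
    partition n (v′ ∘ suc) (∁ (replicate n false))
      ≡⟨ ≡.cong (partition n (v′ ∘ suc)) (Vec.map-replicate not false n) ⟩
    Z n (v′ ∘ suc) ∎)))
    where
    v′ : ℕ → ℕ → Carrier
    v′ r = w* r ∘ suc

  -- Perfect matchings of `AD n` as sums over strips.

  ∑-sublists-++ : ∀ (xs ys : List A) f →
    ∑ (sublists (xs ++ ys)) f ≈ ∑ (sublists xs) (λ α → ∑ (sublists ys) (λ β → f (α ++ β)))
  ∑-sublists-++ []       ys f = sym (+-identityʳ _)
  ∑-sublists-++ (x ∷ xs) ys f = begin
    ∑ (map (x ∷_) (sublists (xs ++ ys)) ++ sublists (xs ++ ys)) f
      ≈⟨ ∑-++ (map (x ∷_) (sublists (xs ++ ys))) _ f ⟩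
    ∑ (map (x ∷_) (sublists (xs ++ ys))) f + ∑ (sublists (xs ++ ys)) f
      ≡⟨ ≡.cong (_+ ∑ (sublists (xs ++ ys)) f) (∑-map (x ∷_) (sublists (xs ++ ys)) f) ⟩
    ∑ (sublists (xs ++ ys)) (f ∘ (x ∷_)) + ∑ (sublists (xs ++ ys)) f
      ≈⟨ +-cong (∑-sublists-++ xs ys (f ∘ (x ∷_))) (∑-sublists-++ xs ys f) ⟩
    ∑ (sublists xs) (λ α → g (x ∷ α)) + ∑ (sublists xs) g
      ≡⟨ ≡.cong (_+ ∑ (sublists xs) g) (∑-map (x ∷_) (sublists xs) g) ⟨
    ∑ (map (x ∷_) (sublists xs)) g + ∑ (sublists xs) g
      ≈⟨ ∑-++ (map (x ∷_) (sublists xs)) (sublists xs) g ⟨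
    ∑ (sublists (x ∷ xs)) g ∎
    where
    g : List _ → Carrier
    g α = ∑ (sublists ys) (λ β → f (α ++ β))

  ∑-sublists-map : ∀ (h : A → B) xs f →
    ∑ (sublists (map h xs)) f ≡ ∑ (sublists xs) (f ∘ map h)
  ∑-sublists-map h xs f =
    ≡.trans (≡.cong (λ l → ∑ l f) (sublists-map h xs)) (∑-map (map h) (sublists xs) f)

  ∑-sublists-strips : ∀ m k f →
    ∑ (sublists (strips (suc m) k)) f ≈
    ∑ (sublists (cols k)) (λ α → ∑ (sublists (cols k)) (λ β → ∑ (sublists (strips m k)) (λ ρ →
      f (strip α β ρ))))
  ∑-sublists-strips m k f = begin
    ∑ (sublists (strips (suc m) k)) f
      ≈⟨ ∑-sublists-++ (map (inRow 0) (cols k)) lower f ⟩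
    ∑ (sublists (map (inRow 0) (cols k))) (λ α → ∑ (sublists lower) (λ β → f (α ++ β)))
      ≡⟨ ∑-sublists-map (inRow 0) (cols k) _ ⟩
    ∑ (sublists (cols k)) (λ α → ∑ (sublists lower) (λ β → f (map (inRow 0) α ++ β)))
      ≈⟨ ∑-cong (sublists (cols k)) (λ α → begin
           ∑ (sublists lower) (λ β → f (map (inRow 0) α ++ β))
             ≈⟨ ∑-sublists-++ (map (inRow 1) (cols k)) (map shift (strips m k)) _ ⟩
           ∑ (sublists (map (inRow 1) (cols k))) (λ β → ∑ (sublists (map shift (strips m k))) (λ ρ →
             f (map (inRow 0) α ++ (β ++ ρ))))
             ≡⟨ ∑-sublists-map (inRow 1) (cols k) _ ⟩
           ∑ (sublists (cols k)) (λ β → ∑ (sublists (map shift (strips m k))) (λ ρ →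
             f (map (inRow 0) α ++ (map (inRow 1) β ++ ρ))))
             ≈⟨ ∑-cong (sublists (cols k)) (λ β → reflexive (∑-sublists-map shift (strips m k) _)) ⟩
           ∑ (sublists (cols k)) (λ β → ∑ (sublists (strips m k)) (λ ρ → f (strip α β ρ))) ∎) ⟩
    ∑ (sublists (cols k)) (λ α → ∑ (sublists (cols k)) (λ β → ∑ (sublists (strips m k)) (λ ρ →
      f (strip α β ρ)))) ∎
    where
    lower : List (ℕ × ℕ)
    lower = map (inRow 1) (cols k) ++ map shift (strips m k)

  -- Indicator of degree 1 for `true`, of degree 0 for `false`. The last clause passes to `false`,
  -- so that using an edge at a marked vertex computes to the condition that no other edge meets it.
  is : ℕ → Bool → Carrier
  is zero    false = 1#
  is zero    true  = 0#
  is (suc n) false = 0#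
  is (suc n) true  = is n false

  is-+ : ∀ m n → is (m ℕ.+ n) true ≈ is m true · is n false + is m false · is n true
  is-+ zero          n = sym (trans (+-cong (zeroˡ _) (*-identityˡ _)) (+-identityˡ _))
  is-+ (suc zero)    n = sym (trans (+-cong (*-identityˡ _) (zeroˡ _)) (+-identityʳ _))
  is-+ (suc (suc m)) n = sym (trans (+-cong (zeroˡ _) (zeroˡ _)) (+-identityʳ _))

  are : ∀ {k} → Vec Bool k → (ℕ → ℕ) → Carrier
  are []       f = 1#
  are (b ∷ bs) f = is (f 0) b · are bs (f ∘ suc)

  are-cong : ∀ {k} (bs : Vec Bool k) {f g} → (∀ q → f q ≡ g q) → are bs f ≡ are bs g
  are-cong []       eq = ≡.refl
  are-cong (b ∷ bs) eq = ≡.cong₂ _·_ (≡.cong (λ n → is n b) (eq 0)) (are-cong bs (eq ∘ suc))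

  are-true : ∀ k f → are (replicate k true) f ≡ Π k (λ q → is (f q) true)
  are-true zero    f = ≡.refl
  are-true (suc k) f = ≡.cong (is (f 0) true ·_) (are-true k (f ∘ suc))

  are-interleave : ∀ {n} (S V : Vec Bool n) b f →
    are (b ∷ interleave S V) f ≈ are S (λ j → f (suc (j ℕ.* 2))) · are (b ∷ V) (λ j → f (j ℕ.* 2))
  are-interleave []      []      b f = sym (*-identityˡ _)
  are-interleave (s ∷ S) (τ ∷ V) b f = begin
    is (f 0) b · (is (f 1) s · are (τ ∷ interleave S V) (λ q → f (suc (suc q))))
      ≈⟨ *-congˡ (*-congˡ (are-interleave S V τ (λ q → f (suc (suc q))))) ⟩
    is (f 0) b · (is (f 1) s · (oddPart · evenPart))
      ≈⟨ solve 4 (λ i j k l → i :* (j :* (k :* l)) := j :* k :* (i :* l))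
           refl (is (f 0) b) (is (f 1) s) oddPart evenPart ⟩
    is (f 1) s · oddPart · (is (f 0) b · evenPart) ∎
    where
    oddPart evenPart : Carrier
    oddPart  = are S (λ j → f (suc (suc j ℕ.* 2)))
    evenPart = are (τ ∷ V) (λ j → f (suc j ℕ.* 2))

  -- Two degrees add up to 1 exactly if one is 1 and the other 0; `V` records where the first is 1.
  -- The sums over `V` and `S′` in `partition` arise in this way.
  Π-is-+ : ∀ k f g → Π k (λ j → is (f j ℕ.+ g j) true) ≈
                     ∑ (bits k) (λ V → are V f · are (∁ V) g)
  Π-is-+ zero    f g = sym (trans (+-identityʳ _) (*-identityˡ _))
  Π-is-+ (suc k) f g = begin
    is (f 0 ℕ.+ g 0) true · Π k (λ j → is (f (suc j) ℕ.+ g (suc j)) true)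
      ≈⟨ *-cong (is-+ (f 0) (g 0)) (Π-is-+ k (f ∘ suc) (g ∘ suc)) ⟩
    (is (f 0) true · is (g 0) false + is (f 0) false · is (g 0) true) · Σ
      ≈⟨ distribʳ _ _ _ ⟩
    is (f 0) true · is (g 0) false · Σ + is (f 0) false · is (g 0) true · Σ
      ≈⟨ +-cong (term true) (term false) ⟩
    ∑ (bits k) (h ∘ (true ∷_)) + ∑ (bits k) (h ∘ (false ∷_))
      ≈⟨ ∑-bits k h ⟨
    ∑ (bits (suc k)) h ∎
    where
    h : Vec Bool (suc k) → Carrier
    h V = are V f · are (∁ V) g
    Σ : Carrier
    Σ = ∑ (bits k) (λ V → are V (f ∘ suc) · are (∁ V) (g ∘ suc))
    term : ∀ b → is (f 0) b · is (g 0) (not b) · Σ ≈ ∑ (bits k) (h ∘ (b ∷_))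
    term b = trans (∑-distribˡ (bits k) _ _) (∑-cong (bits k) λ V → interchange _ _ _ _)

  private
    nodes : List ℕ → ℕ → ℕ
    nodes α q = count (near q) α

  nodes-suc : ∀ α q → nodes (map suc α) (suc q) ≡ nodes α q
  nodes-suc α q = count-map (near (suc q)) suc α

  nodes-zero : ∀ α → nodes (map suc α) 0 ≡ 0
  nodes-zero α = ≡.trans (count-map (near 0) suc α) (count-false (λ _ → ≡.refl) α)

  ∑-sublists-cols : ∀ k f → ∑ (sublists (cols (suc k))) f ≈
    ∑ (sublists (cols k)) (λ α → f (0 ∷ map suc α)) + ∑ (sublists (cols k)) (λ α → f (map suc α))
  ∑-sublists-cols k f = trans (∑-++ (map (0 ∷_) (sublists (map suc (cols k)))) _ f)
    (reflexive (≡.cong₂ _+_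
      (≡.trans (∑-map (0 ∷_) (sublists (map suc (cols k))) f) (∑-sublists-map suc (cols k) _))
      (∑-sublists-map suc (cols k) f)))

  -- By cases on the use of the first edge: an unmarked first vertex forbids it, a marked one forces
  -- it, and then the second vertex must be marked and meet no other edge.
  ∑-path : ∀ {k} (bs : Vec Bool (suc k)) w →
           ∑ (sublists (cols k)) (λ α → ∏ α w · are bs (nodes α)) ≈ path bs w
  ∑-path (true ∷ [])  w = solve 0 (con 1 :* (con 0 :* con 1) :+ con 0 := con 0) refl
  ∑-path (false ∷ []) w = solve 0 (con 1 :* (con 1 :* con 1) :+ con 0 := con 1) refl
  ∑-path {suc k} (b ∷ b′ ∷ bs) w = trans
    (trans (∑-sublists-cols k _) (+-cong (∑-cong (sublists (cols k)) used) (∑-cong (sublists (cols k)) unused)))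
    (go b b′)
    where
    C = sublists (cols k)
    w′ = w ∘ suc
    used : ∀ α → ∏ (0 ∷ map suc α) w · are (b ∷ b′ ∷ bs) (nodes (0 ∷ map suc α)) ≈
                 w 0 · ∏ α w′ · (is 1 b · (is (suc (nodes α 0)) b′ · are bs (nodes α ∘ suc)))
    used α = reflexive (≡.cong₂ _·_ (≡.cong (w 0 ·_) (∏-map suc α w))
      (≡.cong₂ _·_ (≡.cong (λ n → is (suc n) b) (nodes-zero α))
        (≡.cong₂ _·_ (≡.cong (λ n → is (suc n) b′) (nodes-suc α 0))
          (are-cong bs λ q → nodes-suc α (suc q)))))
    unused : ∀ α → ∏ (map suc α) w · are (b ∷ b′ ∷ bs) (nodes (map suc α)) ≈
                   ∏ α w′ · (is 0 b · are (b′ ∷ bs) (nodes α))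
    unused α = reflexive (≡.cong₂ _·_ (∏-map suc α w)
      (≡.cong₂ _·_ (≡.cong (λ n → is n b) (nodes-zero α)) (are-cong (b′ ∷ bs) (nodes-suc α))))
    go : ∀ b b′ →
      ∑ C (λ α → w 0 · ∏ α w′ · (is 1 b · (is (suc (nodes α 0)) b′ · are bs (nodes α ∘ suc))))
      + ∑ C (λ α → ∏ α w′ · (is 0 b · are (b′ ∷ bs) (nodes α)))
      ≈ path (b ∷ b′ ∷ bs) w
    go false b′ = trans (+-cong (∑-zero C λ α → trans (*-congˡ (zeroˡ _)) (zeroʳ _))
                                (trans (∑-cong C λ α → *-congˡ (*-identityˡ _)) (∑-path (b′ ∷ bs) w′)))
                        (+-identityˡ _)
    go true true = trans (+-cong (trans (∑-cong C λ α → trans (*-congˡ (*-identityˡ _)) (*-assoc _ _ _))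
                                   (trans (sym (∑-distribˡ C _ _)) (*-congˡ (∑-path (false ∷ bs) w′))))
                                 (∑-zero C λ α → trans (*-congˡ (zeroˡ _)) (zeroʳ _)))
                         (+-identityʳ _)
    go true false = trans (+-cong (∑-zero C λ α → trans (*-congˡ (trans (*-congˡ (zeroˡ _)) (zeroʳ _))) (zeroʳ _))
                                  (∑-zero C λ α → trans (*-congˡ (zeroˡ _)) (zeroʳ _)))
                          (+-identityʳ _)

  private
    odds evens : (ℕ → ℕ) → ℕ → ℕ
    odds  f j = f (suc (j ℕ.* 2))
    evens f j = f (j ℕ.* 2)

  ∑-row : ∀ {n} (S : Vec Bool n) V w →
    ∑ (sublists (cols (n ℕ.* 2))) (λ α → ∏ α w · (are S (odds (nodes α)) · are V (evens (nodes α))))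
    ≈ row S V w
  ∑-row {n} S (b ∷ V) w = trans
    (∑-cong (sublists (cols (n ℕ.* 2))) λ α → *-congˡ (sym (are-interleave S V b (nodes α))))
    (∑-path (b ∷ interleave S V) w)

  -- The indicator of degree one at all vertices except the top row u 0 _.
  below : ℕ → ℕ → (ℕ → ℕ → ℕ) → Carrier
  below n m d = Π m λ i →
    Π (suc n) (λ j → is (d (suc (i ℕ.* 2)) (j ℕ.* 2)) true)
    · Π n (λ j → is (d (suc (suc (i ℕ.* 2))) (suc (j ℕ.* 2))) true)

  Π-cong-≡ : ∀ n {f g : ℕ → Carrier} → (∀ i → f i ≡ g i) → Π n f ≡ Π n g
  Π-cong-≡ zero    eq = ≡.refl
  Π-cong-≡ (suc n) eq = ≡.cong₂ _·_ (eq 0) (Π-cong-≡ n (eq ∘ suc))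

  below-cong : ∀ n m {d d′ : ℕ → ℕ → ℕ} → (∀ p q → d (suc p) q ≡ d′ (suc p) q) → below n m d ≡ below n m d′
  below-cong n m {d} {d′} eq = Π-cong-≡ m λ i → ≡.cong₂ _·_
    (Π-cong-≡ (suc n) λ j → ≡.cong (λ k → is k true) (eq (i ℕ.* 2) (j ℕ.* 2)))
    (Π-cong-≡ n λ j → ≡.cong (λ k → is k true) (eq (suc (i ℕ.* 2)) (suc (j ℕ.* 2))))

  edgeWeight : (ℕ → ℕ → Carrier) → ℕ × ℕ → Carrier
  edgeWeight w (r , s) = w r s

  ∏-strip : ∀ α β ρ w → ∏ (strip α β ρ) (edgeWeight w) ≈
    ∏ α (w 0) · (∏ β (w 1) · ∏ ρ (edgeWeight λ r → w (suc (suc r))))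
  ∏-strip α β ρ w = trans (∏-++ (map (inRow 0) α) _ _)
    (*-cong (reflexive (∏-map (inRow 0) α _))
      (trans (∏-++ (map (inRow 1) β) _ _)
        (*-cong (reflexive (∏-map (inRow 1) β _)) (reflexive (∏-map shift ρ _)))))

  below-strip : ∀ n m α β ρ →
    below n (suc m) (λ p q → degree p q (strip α β ρ))
    ≈ ∑ (bits (suc n)) (λ V → are V (evens (nodes α)) · are (∁ V) (evens (nodes β)))
      · ∑ (bits n) (λ S′ → are S′ (odds (nodes β)) · are (∁ S′) (odds λ q → degree 0 q ρ))
      · below n m (λ p q → degree p q ρ)
  below-strip n m α β ρ = *-cong
    (*-cong
      (trans (Π-cong (suc n) λ j → reflexive (≡.cong (λ k → is k true) (degree-strip-1 (j ℕ.* 2) α β ρ)))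
        (Π-is-+ (suc n) (evens (nodes α)) (evens (nodes β))))
      (trans (Π-cong n λ j → reflexive (≡.cong (λ k → is k true) (degree-strip-2 (suc (j ℕ.* 2)) α β ρ)))
        (Π-is-+ n (odds (nodes β)) (odds λ q → degree 0 q ρ))))
    (reflexive (below-cong n m {λ p q → degree (suc (suc p)) q (strip α β ρ)} {λ p q → degree p q ρ}
      λ p q → degree-strip-3+ p q α β ρ))

  ∑-comm₃ : ∀ {a b c} {A : Set a} {B : Set b} {C : Set c} (xs : List A) (ys : List B) (zs : List C)
    (f : A → B → C → Carrier) →
    ∑ xs (λ x → ∑ ys (λ y → ∑ zs (f x y))) ≈ ∑ zs (λ z → ∑ xs (λ x → ∑ ys (λ y → f x y z)))
  ∑-comm₃ xs ys zs f = trans (∑-cong xs λ x → ∑-comm ys zs (f x)) (∑-comm xs zs (λ x z → ∑ ys (λ y → f x y z)))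

  -- For fixed `d` and `e` the other three sums are independent. In `∑-strips` they run over the
  -- upper row, the lower row and the remaining strips, which interact only through `V` and `S′`.
  ∑-factor : ∀ {a b c d e} {A : Set a} {B : Set b} {C : Set c} {D : Set d} {E : Set e}
    (as : List A) (bs : List B) (cs : List C) (ds : List D) (es : List E)
    (f : A → D → Carrier) (g : B → D → E → Carrier) (h : C → E → Carrier) →
    ∑ as (λ a → ∑ bs λ b → ∑ cs λ c → ∑ ds λ d → ∑ es λ e → f a d · (g b d e · h c e))
    ≈ ∑ ds (λ d → ∑ es λ e → ∑ as (λ a → f a d) · (∑ bs (λ b → g b d e) · ∑ cs (λ c → h c e)))
  ∑-factor as bs cs ds es f g h = sym (begin
    ∑ ds (λ d → ∑ es λ e → ∑ as (λ a → f a d) · (∑ bs (λ b → g b d e) · ∑ cs (λ c → h c e)))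
      ≈⟨ ∑-cong ds (λ d → ∑-cong es λ e → begin
           ∑ as (λ a → f a d) · (∑ bs (λ b → g b d e) · ∑ cs (λ c → h c e))
             ≈⟨ ∑-distribʳ as _ _ ⟩
           ∑ as (λ a → f a d · (∑ bs (λ b → g b d e) · ∑ cs (λ c → h c e)))
             ≈⟨ ∑-cong as (λ a → trans (*-congˡ (∑-∑-distrib bs cs _ _))
                  (trans (∑-distribˡ bs _ _) (∑-cong bs λ b → ∑-distribˡ cs _ _))) ⟩
           ∑ as (λ a → ∑ bs λ b → ∑ cs λ c → f a d · (g b d e · h c e)) ∎) ⟩
    ∑ ds (λ d → ∑ es λ e → ∑ as λ a → ∑ bs λ b → ∑ cs λ c → f a d · (g b d e · h c e))
      ≈⟨ ∑-comm₃ ds es as _ ⟩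
    ∑ as (λ a → ∑ ds λ d → ∑ es λ e → ∑ bs λ b → ∑ cs λ c → f a d · (g b d e · h c e))
      ≈⟨ ∑-cong as (λ a → trans (∑-comm₃ ds es bs _) (∑-cong bs λ b → ∑-comm₃ ds es cs _)) ⟩
    ∑ as (λ a → ∑ bs λ b → ∑ cs λ c → ∑ ds λ d → ∑ es λ e → f a d · (g b d e · h c e)) ∎)

  ∑-strips : ∀ {n} m w (S : Vec Bool n) →
    ∑ (sublists (strips m (n ℕ.* 2))) (λ μ → ∏ μ (edgeWeight w) ·
      (are S (odds λ q → degree 0 q μ) · below n m (λ p q → degree p q μ)))
    ≈ partition m w S
  ∑-strips zero w S = trans (+-identityʳ _) (trans (*-identityˡ _) (trans (*-identityʳ _) (unmatched S)))
    where
    unmatched : ∀ {k} (S : Vec Bool k) → are S (λ _ → 0) ≈ none S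
    unmatched []          = refl
    unmatched (true ∷ S)  = zeroˡ _
    unmatched (false ∷ S) = trans (*-identityˡ _) (unmatched S)
  ∑-strips {n} (suc m) w S = begin
    ∑ (sublists (strips (suc m) (n ℕ.* 2))) (λ μ → ∏ μ (edgeWeight w) ·
      (are S (odds λ q → degree 0 q μ) · below n (suc m) (λ p q → degree p q μ)))
      ≈⟨ ∑-sublists-strips m (n ℕ.* 2) _ ⟩
    ∑ C (λ α → ∑ C λ β → ∑ (sublists (strips m (n ℕ.* 2))) λ ρ → ∏ (strip α β ρ) (edgeWeight w) ·
      (are S (odds λ q → degree 0 q (strip α β ρ)) · below n (suc m) (λ p q → degree p q (strip α β ρ))))
      ≈⟨ ∑-cong C (λ α → ∑-cong C λ β → ∑-cong (sublists (strips m (n ℕ.* 2))) λ ρ → split α β ρ) ⟩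
    ∑ C (λ α → ∑ C λ β → ∑ (sublists (strips m (n ℕ.* 2))) λ ρ → ∑ (bits (suc n)) λ V → ∑ (bits n) λ S′ →
      upper α V · (lower β V S′ · rest ρ S′))
      ≈⟨ ∑-factor C C (sublists (strips m (n ℕ.* 2))) (bits (suc n)) (bits n) upper lower rest ⟩
    ∑ (bits (suc n)) (λ V → ∑ (bits n) λ S′ →
      ∑ C (λ α → upper α V) · (∑ C (λ β → lower β V S′) · ∑ (sublists (strips m (n ℕ.* 2))) (λ ρ → rest ρ S′)))
      ≈⟨ ∑-cong (bits (suc n)) (λ V → ∑-cong (bits n) λ S′ →
           *-cong (∑-row S V (w 0)) (*-cong (∑-row S′ (∁ V) (w 1)) (∑-strips m _ (∁ S′)))) ⟩
    partition (suc m) w S ∎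
    where
    C = sublists (cols (n ℕ.* 2))
    w″ : ℕ → ℕ → Carrier
    w″ r = w (suc (suc r))
    upper : List ℕ → Vec Bool (suc n) → Carrier
    upper α V = ∏ α (w 0) · (are S (odds (nodes α)) · are V (evens (nodes α)))
    lower : List ℕ → Vec Bool (suc n) → Vec Bool n → Carrier
    lower β V S′ = ∏ β (w 1) · (are S′ (odds (nodes β)) · are (∁ V) (evens (nodes β)))
    rest : List (ℕ × ℕ) → Vec Bool n → Carrier
    rest ρ S′ = ∏ ρ (edgeWeight w″) ·
      (are (∁ S′) (odds λ q → degree 0 q ρ) · below n m (λ p q → degree p q ρ))
    split : ∀ α β ρ →
      ∏ (strip α β ρ) (edgeWeight w) ·
        (are S (odds λ q → degree 0 q (strip α β ρ)) · below n (suc m) (λ p q → degree p q (strip α β ρ)))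
      ≈ ∑ (bits (suc n)) (λ V → ∑ (bits n) λ S′ → upper α V · (lower β V S′ · rest ρ S′))
    split α β ρ = begin
      _ ≈⟨ *-cong (∏-strip α β ρ w) (*-cong
             (reflexive (are-cong S λ j → degree-strip-0 (suc (j ℕ.* 2)) α β ρ)) (below-strip n m α β ρ)) ⟩
      (wα · (wβ · wρ)) · (top · ((∑ (bits (suc n)) V² · ∑ (bits n) S²) · rest′))
        ≈⟨ solve 7 (λ wα wβ wρ top vs ss rest′ → (wα :* (wβ :* wρ)) :* (top :* ((vs :* ss) :* rest′))
                                     := vs :* ss :* (wα :* wβ :* wρ :* top :* rest′))
             refl wα wβ wρ top (∑ (bits (suc n)) V²) (∑ (bits n) S²) rest′ ⟩
      ∑ (bits (suc n)) V² · ∑ (bits n) S² · (wα · wβ · wρ · top · rest′)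
        ≈⟨ *-congʳ (∑-∑-distrib (bits (suc n)) (bits n) V² S²) ⟩
      ∑ (bits (suc n)) (λ V → ∑ (bits n) λ S′ → V² V · S² S′) · (wα · wβ · wρ · top · rest′)
        ≈⟨ trans (∑-distribʳ (bits (suc n)) _ _) (∑-cong (bits (suc n)) λ V → ∑-distribʳ (bits n) _ _) ⟩
      ∑ (bits (suc n)) (λ V → ∑ (bits n) λ S′ → V² V · S² S′ · (wα · wβ · wρ · top · rest′))
        ≈⟨ ∑-cong (bits (suc n)) (λ V → ∑-cong (bits n) λ S′ →
             solve 9 (λ wα wβ wρ top rest′ v v′ s′ top″ → v :* v′ :* (s′ :* top″) :* (wα :* wβ :* wρ :* top :* rest′)
                      := wα :* (top :* v) :* (wβ :* (s′ :* v′) :* (wρ :* (top″ :* rest′)))) refl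
               wα wβ wρ top rest′ (are V (evens (nodes α))) (are (∁ V) (evens (nodes β)))
               (are S′ (odds (nodes β))) (are (∁ S′) (odds λ q → degree 0 q ρ))) ⟩
      ∑ (bits (suc n)) (λ V → ∑ (bits n) λ S′ → upper α V · (lower β V S′ · rest ρ S′)) ∎
      where
      wα = ∏ α (w 0)
      wβ = ∏ β (w 1)
      wρ = ∏ ρ (edgeWeight w″)
      top = are S (odds (nodes α))
      rest′ = below n m (λ p q → degree p q ρ)
      V² : Vec Bool (suc n) → Carrier
      V² V = are V (evens (nodes α)) · are (∁ V) (evens (nodes β))
      S² : Vec Bool n → Carrier
      S² S′ = are S′ (odds (nodes β)) · are (∁ S′) (odds λ q → degree 0 q ρ)

  ∑-filter : ∀ {p} {P : A → Set p} (P? : Decidable P) xs f →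
             ∑ (filter P? xs) f ≈ ∑ xs (λ x → f x · ⟦ does (P? x) ⟧)
  ∑-filter P? []       f = refl
  ∑-filter P? (x ∷ xs) f with does (P? x)
  ... | true  = +-cong (sym (*-identityʳ _)) (∑-filter P? xs f)
  ... | false = trans (∑-filter P? xs f) (sym (trans (+-congʳ (zeroʳ _)) (+-identityˡ _)))

  ⟦all?⟧ : ∀ {p} {P : A → Set p} (P? : Decidable P) xs →
           ⟦ does (all? P? xs) ⟧ ≈ ∏ xs (λ x → ⟦ does (P? x) ⟧)
  ⟦all?⟧ P? []       = refl
  ⟦all?⟧ P? (x ∷ xs) with does (P? x)
  ... | true  = trans (⟦all?⟧ P? xs) (sym (*-identityˡ _))
  ... | false = sym (zeroˡ _)

  ⟦≟1⟧ : ∀ n → ⟦ does (n ℕ.≟ 1) ⟧ ≡ is n true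
  ⟦≟1⟧ zero          = ≡.refl
  ⟦≟1⟧ (suc zero)    = ≡.refl
  ⟦≟1⟧ (suc (suc n)) = ≡.refl

  ∏-cartesianProductWith : ∀ {a b c} {A : Set a} {B : Set b} {C : Set c} (h : A → B → C) xs ys f →
    ∏ (cartesianProductWith h xs ys) f ≈ ∏ xs (λ x → ∏ ys (λ y → f (h x y)))
  ∏-cartesianProductWith h []       ys f = refl
  ∏-cartesianProductWith h (x ∷ xs) ys f = trans (∏-++ (map (h x) ys) _ f)
    (*-cong (reflexive (∏-map (h x) ys f)) (∏-cartesianProductWith h xs ys f))

  ∏-allFin : ∀ k (f : ℕ → Carrier) → ∏ (allFin k) (f ∘ toℕ) ≡ Π k f
  ∏-allFin zero    f = ≡.refl
  ∏-allFin (suc k) f = ≡.trans (≡.cong (λ l → ∏ l (f ∘ toℕ)) (allFin-suc k))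
    (≡.cong (f 0 ·_) (≡.trans (∏-map Fin.suc (allFin k) _) (∏-allFin k (f ∘ suc))))

  -- `below` pairs each vertex row `v i` with the row `u (i + 1)`; the row `u 0` is left over and
  -- becomes the set above the first strip.
  ∏-vertices : ∀ n (d : ℕ → ℕ → ℕ) →
    ∏ (FiniteGraph.vertices (AD n)) (λ τ → is (d (proj₁ (point τ)) (proj₂ (point τ))) true)
    ≈ are (replicate n true) (odds (d 0)) · below n n d
  ∏-vertices n d = begin
    ∏ (cartesianProductWith u (allFin (suc n)) (allFin n) ++ _) f
      ≈⟨ ∏-++ (cartesianProductWith u (allFin (suc n)) (allFin n)) _ f ⟩
    ∏ (cartesianProductWith u (allFin (suc n)) (allFin n)) f
      · ∏ (cartesianProductWith v (allFin n) (allFin (suc n))) f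
      ≈⟨ *-cong (grid u U λ _ _ → refl) (grid v V λ _ _ → refl) ⟩
    Π n (U 0) · Π n (λ i → Π n (U (suc i))) · Π n (λ i → Π (suc n) (V i))
      ≈⟨ trans (*-assoc _ _ _) (*-congˡ (trans (*-comm _ _) (sym (Π-· n _ _)))) ⟩
    Π n (U 0) · below n n d
      ≡⟨ ≡.cong (_· below n n d) (are-true n (odds (d 0))) ⟨
    are (replicate n true) (odds (d 0)) · below n n d ∎
    where
    f : ADVertex n → Carrier
    f τ = is (d (proj₁ (point τ)) (proj₂ (point τ))) true
    U V : ℕ → ℕ → Carrier
    U i j = is (d (i ℕ.* 2) (suc (j ℕ.* 2))) true
    V i j = is (d (suc (i ℕ.* 2)) (j ℕ.* 2)) true
    grid : ∀ {k l} (h : Fin k → Fin l → ADVertex n) (g : ℕ → ℕ → Carrier) →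
      (∀ i j → f (h i j) ≈ g (toℕ i) (toℕ j)) →
      ∏ (cartesianProductWith h (allFin k) (allFin l)) f ≈ Π k (λ i → Π l (g i))
    grid {k} {l} h g eq = begin
      ∏ (cartesianProductWith h (allFin k) (allFin l)) f
        ≈⟨ ∏-cartesianProductWith h (allFin k) (allFin l) f ⟩
      ∏ (allFin k) (λ i → ∏ (allFin l) λ j → f (h i j))
        ≈⟨ ∏-cong (allFin k) (λ i → trans (∏-cong (allFin l) (eq i)) (reflexive (∏-allFin l (g (toℕ i))))) ⟩
      ∏ (allFin k) (λ i → Π l (g (toℕ i)))
        ≡⟨ ∏-allFin k (λ i → Π l (g i)) ⟩
      Π k (λ i → Π l (g i)) ∎

  M-AD≈Z : ∀ n wt w → (∀ r s → wt (r , s) ≈ w (toℕ r) (toℕ s)) → M (AD n) wt ≈ Z n w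
  M-AD≈Z n wt w eq = begin
    ∑ (filter isPerfectMatching? (sublists edges)) (λ μ → ∏ μ wt)
      ≈⟨ ∑-filter isPerfectMatching? (sublists edges) _ ⟩
    ∑ (sublists edges) (λ μ → ∏ μ wt · ⟦ does (isPerfectMatching? μ) ⟧)
      ≈⟨ ∑-cong (sublists edges) (λ μ → *-cong
           (trans (∏-cong μ λ (r , s) → eq r s) (sym (reflexive (∏-map toℕ² μ (edgeWeight w)))))
           (begin
             ⟦ does (isPerfectMatching? μ) ⟧
               ≈⟨ ⟦all?⟧ (λ τ → length (filter (incidentTo? τ) μ) ℕ.≟ 1) vertices ⟩
             ∏ vertices (λ τ → ⟦ does (length (filter (incidentTo? τ) μ) ℕ.≟ 1) ⟧)
               ≈⟨ ∏-cong vertices (λ τ → reflexive (≡.trans (⟦≟1⟧ (length (filter (incidentTo? τ) μ)))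
                    (≡.cong (λ k → is k true) (length-incident τ μ)))) ⟩
             ∏ vertices (λ τ → is (degree (proj₁ (point τ)) (proj₂ (point τ)) (map toℕ² μ)) true)
               ≈⟨ ∏-vertices n (λ p q → degree p q (map toℕ² μ)) ⟩
             constraint (map toℕ² μ) ∎)) ⟩
    ∑ (sublists edges) (λ μ → ∏ (map toℕ² μ) (edgeWeight w) · constraint (map toℕ² μ))
      ≡⟨ ∑-sublists-map toℕ² edges _ ⟨
    ∑ (sublists (map toℕ² edges)) (λ μ → ∏ μ (edgeWeight w) · constraint μ)
      ≡⟨ ≡.cong (λ l → ∑ (sublists l) (λ μ → ∏ μ (edgeWeight w) · constraint μ)) (edges≡strips n) ⟩
    ∑ (sublists (strips n (n ℕ.* 2))) (λ μ → ∏ μ (edgeWeight w) · constraint μ)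
      ≈⟨ ∑-strips n w (replicate n true) ⟩
    Z n w ∎
    where
    open FiniteGraph (AD n) using (edges; vertices; incidentTo?; isPerfectMatching?)
    constraint : List (ℕ × ℕ) → Carrier
    constraint μ = are (replicate n true) (odds λ q → degree 0 q μ) · below n n (λ p q → degree p q μ)

  -- Powers of entries and the product over the kept rows.

  Π-const : ∀ k a → Π k (λ _ → a) ≈ a ^ k
  Π-const zero    a = refl
  Π-const (suc k) a = *-congˡ (Π-const k a)

  Π-one : ∀ k {f} → (∀ i → f i ≈ 1#) → Π k f ≈ 1#
  Π-one zero    eq = refl
  Π-one (suc k) eq = trans (*-cong (eq 0) (Π-one k (eq ∘ suc))) (*-identityˡ _)

  Π-double : ∀ n f → Π (n ℕ.* 2) f ≈ Π n (λ i → f (i ℕ.* 2)) · Π n (λ i → f (suc (i ℕ.* 2)))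
  Π-double zero    f = sym (*-identityˡ _)
  Π-double (suc n) f = begin
    f 0 · (f 1 · Π (n ℕ.* 2) (λ i → f (suc (suc i))))
      ≈⟨ *-congˡ (*-congˡ (Π-double n λ i → f (suc (suc i)))) ⟩
    f 0 · (f 1 · (Π n (λ i → f (suc i ℕ.* 2)) · Π n (λ i → f (suc (suc i ℕ.* 2)))))
      ≈⟨ solve 4 (λ a b c d → a :* (b :* (c :* d)) := a :* c :* (b :* d)) refl (f 0) (f 1) _ _ ⟩
    f 0 · Π n (λ i → f (suc i ℕ.* 2)) · (f 1 · Π n (λ i → f (suc (suc i ℕ.* 2)))) ∎

  Π-pick-even : ∀ k p q → Π (k ℕ.* 2) (λ j → pick (j ℕ.* 2) p q) ≈ p ^ k · q ^ k
  Π-pick-even zero    p q = sym (*-identityˡ _)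
  Π-pick-even (suc k) p q = begin
    p · (q · Π (k ℕ.* 2) (λ j → pick (j ℕ.* 2) p q)) ≈⟨ *-congˡ (*-congˡ (Π-pick-even k p q)) ⟩
    p · (q · (p ^ k · q ^ k))
      ≈⟨ solve 4 (λ a b c d → a :* (b :* (c :* d)) := a :* c :* (b :* d)) refl p q (p ^ k) (q ^ k) ⟩
    p ^ suc k · q ^ suc k                        ∎

  Π-pick-odd : ∀ k p q → Π (suc (k ℕ.* 2)) (λ j → pick (j ℕ.* 2) p q) ≈ p ^ suc k · q ^ k
  Π-pick-odd k p q = begin
    p · Π (k ℕ.* 2) (λ j → pick (j ℕ.* 2) q p) ≈⟨ *-congˡ (Π-pick-even k q p) ⟩
    p · (q ^ k · p ^ k)                    ≈⟨ *-congˡ (*-comm _ _) ⟩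
    p · (p ^ k · q ^ k)                    ≈⟨ *-assoc _ _ _ ⟨
    p ^ suc k · q ^ k                      ∎

  when : Bool → Carrier → Carrier
  when b a = if b then a else 1#

  ∏-filter : ∀ {p} {P : A → Set p} (P? : Decidable P) xs f →
             ∏ (filter P? xs) f ≈ ∏ xs (λ r → when (does (P? r)) (f r))
  ∏-filter P? []       f = refl
  ∏-filter P? (r ∷ xs) f with does (P? r)
  ... | true  = *-congˡ (∏-filter P? xs f)
  ... | false = trans (∏-filter P? xs f) (sym (*-identityˡ _))

  Π-drop-last : ∀ m f → Π (suc m) (λ i → when (not (i ≡ᵇ m)) (f i)) ≈ Π m f
  Π-drop-last zero    f = *-identityˡ _
  Π-drop-last (suc m) f = *-congˡ (Π-drop-last m (f ∘ suc))

  ∏-rows : ∀ m (g : Fin (suc m ℕ.* 2) → Carrier) (f : ℕ → Carrier) → (∀ r → g r ≈ f (toℕ r)) →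
    ∏ (rows≢2,2n-1 (suc m)) g ≈ Π m (λ i → f (i ℕ.* 2)) · Π m (λ i → f (suc (suc (suc (i ℕ.* 2)))))
  ∏-rows m g f eq = begin
    ∏ (rows≢2,2n-1 (suc m)) g
      ≈⟨ ∏-filter _ (allFin (suc m ℕ.* 2)) g ⟩
    ∏ (allFin (suc m ℕ.* 2)) (λ r → when (kept r) (g r))
      ≈⟨ ∏-cong (allFin (suc m ℕ.* 2)) (λ r → trans
           (reflexive (≡.cong (λ l → when (not (toℕ r ≡ᵇ 1) ∧ not (suc (toℕ r) ≡ᵇ l)) (g r)) 2n∸1))
           (when-cong (keeps m (toℕ r)) (eq r))) ⟩
    ∏ (allFin (suc m ℕ.* 2)) (λ r → when (keeps m (toℕ r)) (f (toℕ r)))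
      ≡⟨ ∏-allFin (suc m ℕ.* 2) (λ r → when (keeps m r) (f r)) ⟩
    Π (suc m ℕ.* 2) (λ r → when (keeps m r) (f r))
      ≈⟨ Π-double (suc m) (λ r → when (keeps m r) (f r)) ⟩
    Π (suc m) (λ i → when (keeps m (i ℕ.* 2)) (f (i ℕ.* 2)))
      · Π (suc m) (λ i → when (keeps m (suc (i ℕ.* 2))) (f (suc (i ℕ.* 2))))
      ≈⟨ *-cong
           (trans (Π-cong (suc m) λ i → reflexive (≡.cong (λ b → when b (f (i ℕ.* 2))) (keeps-even m i)))
             (Π-drop-last m λ i → f (i ℕ.* 2)))
           -- The first odd index is an excluded row, whose factor is 1.
           (trans (*-identityˡ _)
             (Π-cong m λ i → reflexive (≡.cong (λ b → when b (f (suc (suc i ℕ.* 2)))) (keeps-odd m i)))) ⟩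
    Π m (λ i → f (i ℕ.* 2)) · Π m (λ i → f (suc (suc (suc (i ℕ.* 2))))) ∎
    where
    kept : Fin (suc m ℕ.* 2) → Bool
    kept r = not (suc (toℕ r) ≡ᵇ 2) ∧ not (suc (toℕ r) ≡ᵇ 2 ℕ.* suc m ∸ 1)
    2n∸1 : 2 ℕ.* suc m ∸ 1 ≡ suc (m ℕ.* 2)
    2n∸1 = ≡.cong (_∸ 1) (ℕ.*-comm 2 (suc m))
    when-cong : ∀ b {p q} → p ≈ q → when b p ≈ when b q
    when-cong true  eq = eq
    when-cong false eq = refl

  -- The two renewals of the weight of `T`.

  -- The half-turn of p p / q q is q q / p p, and dividing it by p q gives the entrywise inverses of
  -- the original cell. Hence aa* and bb* are both 1, which is the origin of the powers of 2.
  inverses-dual : ∀ {w w⁻ : ℕ → ℕ → Carrier} →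
    (∀ r s → w r s · w⁻ r s ≈ 1#) →
    (∀ r j → w r (suc (j ℕ.* 2)) ≡ w r (j ℕ.* 2)) → (∀ r j → w⁻ r (suc (j ℕ.* 2)) ≡ w⁻ r (j ℕ.* 2)) →
    ∀ i → Dual (w (i ℕ.* 2)) (w (suc (i ℕ.* 2))) (w⁻ (i ℕ.* 2)) (w⁻ (suc (i ℕ.* 2)))
               (λ j → w (i ℕ.* 2) (j ℕ.* 2) · w (suc (i ℕ.* 2)) (j ℕ.* 2)) (1# + 1#)
  inverses-dual {w} {w⁻} ww⁻≈1 w≡ w⁻≡ i = record
    { a≈ωd*     = λ j → trans (cancelʳ j) (*-congˡ (reflexive (≡.sym (w⁻≡ _ j))))
    ; b≈ωc*     = λ j → trans (reflexive (w≡ _ j)) (cancelʳ j)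
    ; c≈ωb*     = λ j → trans (cancelˡ j) (*-congˡ (reflexive (≡.sym (w⁻≡ _ j))))
    ; d≈ωa*     = λ j → trans (reflexive (w≡ _ j)) (cancelˡ j)
    ; aa*+bb*≈δ = λ j → +-cong (ww⁻≈1 _ _) (ww⁻≈1 _ _)
    }
    where
    p q : ℕ → Carrier
    p j = w (i ℕ.* 2) (j ℕ.* 2)
    q j = w (suc (i ℕ.* 2)) (j ℕ.* 2)
    cancelʳ : ∀ j → p j ≈ p j · q j · w⁻ (suc (i ℕ.* 2)) (j ℕ.* 2)
    cancelʳ j = sym (trans (*-assoc _ _ _) (trans (*-congˡ (ww⁻≈1 _ _)) (*-identityʳ _)))
    cancelˡ : ∀ j → q j ≈ p j · q j · w⁻ (i ℕ.* 2) (j ℕ.* 2)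
    cancelˡ j = sym (trans (xy∙z≈xz∙y _ _ _) (trans (*-congʳ (ww⁻≈1 _ _)) (*-identityˡ _)))

  -- Consecutive cells of a strip are p q / p′ q′ and q p / q′ p′, which have the same ad + bc. This
  -- makes δ constant along the strip in the first renewal.
  pick-cross : ∀ j p q p′ q′ →
    pick (j ℕ.* 2) p q · pick (suc (j ℕ.* 2)) p′ q′ + pick (suc (j ℕ.* 2)) p q · pick (j ℕ.* 2) p′ q′
    ≈ p · q′ + q · p′
  pick-cross zero    p q p′ q′ = refl
  pick-cross (suc j) p q p′ q′ = trans (pick-cross j q p q′ p′) (+-comm _ _)

  pick-inverse : ∀ s {p q p⁻ q⁻} → p · p⁻ ≈ 1# → q · q⁻ ≈ 1# → pick s p q · pick s p⁻ q⁻ ≈ 1#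
  pick-inverse zero          pp⁻ qq⁻ = pp⁻
  pick-inverse (suc zero)    pp⁻ qq⁻ = qq⁻
  pick-inverse (suc (suc s)) pp⁻ qq⁻ = pick-inverse s qq⁻ pp⁻

  swap-dual : ∀ (X Y : ℕ → Carrier) i →
    Dual (λ s → pick s (X (i ℕ.* 2)) (Y (i ℕ.* 2))) (λ s → pick s (X (suc (i ℕ.* 2))) (Y (suc (i ℕ.* 2))))
         (λ s → pick (swap₂ s) (X (swap₂ (i ℕ.* 2))) (Y (swap₂ (i ℕ.* 2))))
         (λ s → pick (swap₂ s) (X (swap₂ (suc (i ℕ.* 2)))) (Y (swap₂ (suc (i ℕ.* 2)))))
         (λ _ → 1#)
         (X (i ℕ.* 2) · Y (suc (i ℕ.* 2)) + X (suc (i ℕ.* 2)) · Y (i ℕ.* 2))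
  swap-dual X Y i rewrite swap₂-even i | swap₂-odd i = record
    { a≈ωd*     = λ j → sym (trans (*-identityˡ _) (at (swap₂-odd j)))
    ; b≈ωc*     = λ j → sym (trans (*-identityˡ _) (at (swap₂-even j)))
    ; c≈ωb*     = λ j → sym (trans (*-identityˡ _) (at (swap₂-odd j)))
    ; d≈ωa*     = λ j → sym (trans (*-identityˡ _) (at (swap₂-even j)))
    ; aa*+bb*≈δ = λ j → trans
        (+-cong (*-congˡ (at (swap₂-even j))) (*-congˡ (at (swap₂-odd j))))
        (trans (pick-cross j _ _ _ _) (+-congˡ (*-comm _ _)))
    }
    where
    at : ∀ {s s′ p q} → s ≡ s′ → pick s p q ≈ pick s′ p q
    at {p = p} {q} eq = reflexive (≡.cong (λ s → pick s p q) eq)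

  z-pick : ∀ {n} (T : Matrix n) r s → z {n} T (r , s) ≡ pick (toℕ s) (x T r) (y T r)
  z-pick {n} T r s = ≡.trans select (pick-mod (toℕ s) f ≡.refl ≡.refl)
    where
    f : Fin 4 → Carrier
    f 0F = x T r
    f 1F = x T r
    f 2F = y T r
    f 3F = y T r
    select : z {n} T (r , s) ≡ f (suc (toℕ s) mod 4)
    select with suc (toℕ s) mod 4
    ... | 0F = ≡.refl
    ... | 1F = ≡.refl
    ... | 2F = ≡.refl
    ... | 3F = ≡.refl

  unitRow : Row
  unitRow = [ one , one ]
    where
    one : Unit
    one = record { value = 1# ; inverse = 1# ; inverseʳ = *-identityˡ _ }

  -- Rows beyond the matrix are filled with ones, so that the duality of the weights
  -- holds at all indices.
  x̂ ŷ x̂⁻¹ ŷ⁻¹ : ∀ {k} → (Fin k → Row) → ℕ → Carrier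
  x̂   T r = Unit.value (Row.fst (extend unitRow T r))
  ŷ   T r = Unit.value (Row.snd (extend unitRow T r))
  x̂⁻¹ T r = Unit.inverse (Row.fst (extend unitRow T r))
  ŷ⁻¹ T r = Unit.inverse (Row.snd (extend unitRow T r))

  -- The weight on AD_{n-1} left by the first renewal.
  middle middle⁻¹ : ∀ {k} → (Fin k → Row) → ℕ → ℕ → Carrier
  middle   T r s = pick (swap₂ (suc s)) (x̂ T (swap₂ (suc r))) (ŷ T (swap₂ (suc r)))
  middle⁻¹ T r s = pick (swap₂ (suc s)) (x̂⁻¹ T (swap₂ (suc r))) (ŷ⁻¹ T (swap₂ (suc r)))

  M≈Z-middle : ∀ m (T : Matrix (suc m)) →
    M (AD (suc m)) (z {suc m} T) ≈ ∏ (allFin (suc m)) (Δ {suc m} T) · Z m (middle T)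
  M≈Z-middle m T = begin
    M (AD (suc m)) (z {suc m} T)
      ≈⟨ M-AD≈Z (suc m) _ w (λ r s → reflexive (≡.trans (z-pick {suc m} T r s)
           (≡.cong (λ row → pick (toℕ s) (Unit.value (Row.fst row)) (Unit.value (Row.snd row)))
             (≡.sym (extend-toℕ unitRow T r))))) ⟩
    Z (suc m) w
      ≈⟨ Z-dual m {w} {w*} {λ _ _ → 1#} {δ} (swap-dual (x̂ T) (ŷ T)) ⟩
    Π (suc m) δ · (Π (suc m) (λ _ → Π (suc m) (λ _ → 1#)) · Z m (middle T))
      ≈⟨ *-congˡ (trans (*-congʳ (Π-one (suc m) λ _ → Π-one (suc m) λ _ → refl)) (*-identityˡ _)) ⟩
    Π (suc m) δ · Z m (middle T)
      ≡⟨ ≡.cong (_· Z m (middle T)) (∏-allFin (suc m) δ) ⟨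
    ∏ (allFin (suc m)) (δ ∘ toℕ) · Z m (middle T)
      ≈⟨ *-congʳ (∏-cong (allFin (suc m)) λ i → reflexive (≡.sym (≡.cong₂
           (λ row row′ → Unit.value (Row.fst row) · Unit.value (Row.snd row′)
                       + Unit.value (Row.fst row′) · Unit.value (Row.snd row))
           (entry i 0F) (entry i 1F)))) ⟩
    ∏ (allFin (suc m)) (Δ {suc m} T) · Z m (middle T) ∎
    where
    w w* : ℕ → ℕ → Carrier
    w r s  = pick s (x̂ T r) (ŷ T r)
    w* r s = pick (swap₂ s) (x̂ T (swap₂ r)) (ŷ T (swap₂ r))
    δ : ℕ → Carrier
    δ i = x̂ T (i ℕ.* 2) · ŷ T (suc (i ℕ.* 2)) + x̂ T (suc (i ℕ.* 2)) · ŷ T (i ℕ.* 2)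
    entry : ∀ i (a : Fin 2) → T (combine i a) ≡ extend unitRow T (toℕ a ℕ.+ toℕ i ℕ.* 2)
    entry i a = ≡.trans (≡.sym (extend-toℕ unitRow T (combine i a)))
                        (≡.cong (extend unitRow T) (toℕ-combine-2 i a))

  Z-middle≈M : ∀ m (T : Matrix (suc (suc m))) →
    Z (suc m) (middle T) ≈
    (1# + 1#) ^ suc m
    · (Π (suc m) (λ i → Π (suc m) (λ j → middle T (i ℕ.* 2) (j ℕ.* 2) · middle T (suc (i ℕ.* 2)) (j ℕ.* 2)))
      · M (AD m) (z {m} (t {m} T)))
  Z-middle≈M m T = begin
    Z (suc m) (middle T)
      ≈⟨ Z-dual m {middle T} {middle⁻¹ T} (inverses-dual
           (λ r s → pick-inverse (swap₂ (suc s))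
             (Unit.inverseʳ (Row.fst (extend unitRow T (swap₂ (suc r)))))
             (Unit.inverseʳ (Row.snd (extend unitRow T (swap₂ (suc r))))))
           (λ r j → pick-paired j _ _) (λ r j → pick-paired j _ _)) ⟩
    Π (suc m) (λ _ → 1# + 1#) · (ωs · Z m (λ r s → middle⁻¹ T (suc r) (suc s)))
      ≈⟨ *-cong (Π-const (suc m) _) (*-congˡ (sym (M-AD≈Z m _ _ λ r s → reflexive (weights r s)))) ⟩
    (1# + 1#) ^ suc m · (ωs · M (AD m) (z {m} (t {m} T))) ∎
    where
    ωs : Carrier
    ωs = Π (suc m) (λ i → Π (suc m) (λ j → middle T (i ℕ.* 2) (j ℕ.* 2) · middle T (suc (i ℕ.* 2)) (j ℕ.* 2)))
    weights : ∀ r s → z {m} (t {m} T) (r , s) ≡ middle⁻¹ T (suc (toℕ r)) (suc (toℕ s))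
    weights r s = ≡.trans (z-pick {m} (t {m} T) r s) (≡.trans
      (≡.cong (λ row → pick (toℕ s) (Unit.inverse (Row.fst row)) (Unit.inverse (Row.snd row))) entry)
      (≡.sym (pick-swap₂ (toℕ s) _ _)))
      where
      r′ = combine (Fin.suc (inject₁ (proj₁ (remQuot {m} 2 r)))) (opposite (proj₂ (remQuot {m} 2 r)))
      entry : T r′ ≡ extend unitRow T (suc (suc (swap₂ (toℕ r))))
      entry = ≡.trans (≡.sym (extend-toℕ unitRow T r′)) (≡.cong (extend unitRow T) (toℕ-t {m} r))

  -- Counted from 0, strip `i` of the middle weight takes its rows from rows `2i` and `2i + 3` of
  -- `T`. As `i` runs below `m`, every row occurs once, except 1 and `2m`.
  ∏-rows-power : ∀ m (T : Matrix (suc m)) a b →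
    (∀ p q → Π m (λ j → pick (j ℕ.* 2) p q) ≈ p ^ a · q ^ b) →
    Π m (λ i → Π m (λ j → middle T (i ℕ.* 2) (j ℕ.* 2) · middle T (suc (i ℕ.* 2)) (j ℕ.* 2)))
    ≈ ∏ (rows≢2,2n-1 (suc m)) (λ i → x T i ^ a · y T i ^ b)
  ∏-rows-power m T a b powers = begin
    Π m (λ i → Π m (λ j → middle T (i ℕ.* 2) (j ℕ.* 2) · middle T (suc (i ℕ.* 2)) (j ℕ.* 2)))
      ≈⟨ Π-cong m (λ i → trans (Π-· m _ _) (*-cong
           (trans (Π-cong m λ j → reflexive (≡.cong₂ at (swap₂-odd j) (swap₂-odd i))) (powers _ _))
           (trans (Π-cong m λ j → reflexive (≡.cong₂ at (swap₂-odd j)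
             (≡.cong (λ r → suc (suc r)) (swap₂-even i)))) (powers _ _)))) ⟩
    Π m (λ i → f (i ℕ.* 2) · f (suc (suc (suc (i ℕ.* 2)))))
      ≈⟨ Π-· m _ _ ⟩
    Π m (λ i → f (i ℕ.* 2)) · Π m (λ i → f (suc (suc (suc (i ℕ.* 2)))))
      ≈⟨ ∏-rows m _ f (λ r → reflexive (≡.cong
           (λ row → Unit.value (Row.fst row) ^ a · Unit.value (Row.snd row) ^ b)
           (≡.sym (extend-toℕ unitRow T r)))) ⟨
    ∏ (rows≢2,2n-1 (suc m)) (λ i → x T i ^ a · y T i ^ b) ∎
    where
    at : ℕ → ℕ → Carrier
    at s r = pick s (x̂ T r) (ŷ T r)
    f : ℕ → Carrier
    f r = x̂ T r ^ a · ŷ T r ^ b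

  -- The parity of n enters only through the numbers of x and y among the `m` alternating entries.
  -- With this count as the hypothesis `powers`, one argument serves both parities.
  M-reduction : ∀ m (T : Matrix (suc m)) a b →
    (∀ p q → Π m (λ j → pick (j ℕ.* 2) p q) ≈ p ^ a · q ^ b) →
    M (AD (suc m)) (z {suc m} T) ≈
    (1# + 1#) ^ m · ∏ (allFin (suc m)) (Δ {suc m} T)
    · ∏ (rows≢2,2n-1 (suc m)) (λ i → x T i ^ a · y T i ^ b)
    · M-AD[n-2] (suc m) T
  M-reduction m T a b powers = begin
    M (AD (suc m)) (z {suc m} T)
      ≈⟨ M≈Z-middle m T ⟩
    Δs · Z m (middle T)
      ≈⟨ *-congˡ (Z-middle m T powers) ⟩
    Δs · ((1# + 1#) ^ m · (rows · M-AD[n-2] (suc m) T))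
      ≈⟨ solve 4 (λ a b c d → a :* (b :* (c :* d)) := b :* a :* c :* d) refl
           Δs ((1# + 1#) ^ m) rows (M-AD[n-2] (suc m) T) ⟩
    (1# + 1#) ^ m · Δs · rows · M-AD[n-2] (suc m) T ∎
    where
    Δs rows : Carrier
    Δs   = ∏ (allFin (suc m)) (Δ {suc m} T)
    rows = ∏ (rows≢2,2n-1 (suc m)) (λ i → x T i ^ a · y T i ^ b)
    Z-middle : ∀ m (T : Matrix (suc m)) →
      (∀ p q → Π m (λ j → pick (j ℕ.* 2) p q) ≈ p ^ a · q ^ b) →
      Z m (middle T) ≈ (1# + 1#) ^ m ·
        (∏ (rows≢2,2n-1 (suc m)) (λ i → x T i ^ a · y T i ^ b) · M-AD[n-2] (suc m) T)
    -- For n = 1 the excluded rows 2 and 2n-1 = 1 are all the rows, so the product is empty, and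
    -- both matching sums are 1.
    Z-middle zero    T powers = sym (trans (*-identityˡ _) (*-identityˡ _))
    Z-middle (suc m) T powers =
      trans (Z-middle≈M m T) (*-congˡ (*-congʳ (∏-rows-power (suc m) T a b powers)))

theorem5p1 : ∀ {c ℓ} (R : CommutativeRing c ℓ) →
    let open CommutativeRing R
        open Weighted R
    in
    (n : ℕ) .{{_ : NonZero n}} (T : Matrix n) →
    (2 ∣ n →
      M (AD n) (z {n} T)
        ≈ (1# + 1#) ^ (n ∸ 1)
          * ∏ (allFin n) (Δ {n} T)
          * ∏ (rows≢2,2n-1 n) (λ i → x T i ^ (n / 2) * y T i ^ (n / 2 ∸ 1))
          * M-AD[n-2] n T)
    × (2 ∤ n →
      M (AD n) (z {n} T)
        ≈ (1# + 1#) ^ (n ∸ 1)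
          * ∏ (allFin n) (Δ {n} T)
          * ∏ (rows≢2,2n-1 n) (λ i → x T i ^ ((n ∸ 1) / 2) * y T i ^ ((n ∸ 1) / 2))
          * M-AD[n-2] n T)
theorem5p1 R (suc m) T with parity m
-- Here n is `suc m`, so an even `m` is the case of odd n.
... | even k = (λ 2∣n → contradiction 2∣n (2∤1+2k k)) , (λ _ → M-reduction (k ℕ.* 2) T (k ℕ.* 2 / 2) (k ℕ.* 2 / 2) powers)
  where
  open Dimers R
  powers : ∀ p q → Π (k ℕ.* 2) (λ j → pick (j ℕ.* 2) p q) ≈ p ^ (k ℕ.* 2 / 2) · q ^ (k ℕ.* 2 / 2)
  half : k ℕ.* 2 / 2 ≡ k
  half = m*n/n≡m k 2
  powers p q rewrite half = Π-pick-even k p q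
... | odd k = (λ _ → M-reduction (suc (k ℕ.* 2)) T (suc k ℕ.* 2 / 2) (suc k ℕ.* 2 / 2 ∸ 1) powers)
            , (λ 2∤n → contradiction (divides (suc k) ≡.refl) 2∤n)
  where
  open Dimers R
  powers : ∀ p q → Π (suc (k ℕ.* 2)) (λ j → pick (j ℕ.* 2) p q) ≈ p ^ (suc k ℕ.* 2 / 2) · q ^ (suc k ℕ.* 2 / 2 ∸ 1)
  half : suc k ℕ.* 2 / 2 ≡ suc k
  half = m*n/n≡m (suc k) 2
  powers p q rewrite half = Π-pick-odd k p q
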